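{- The sample complexity of $\epsilon$-testing the $(q,k)$-Colorability property satisfies $$\mathcal{S}_{(q,k)\text{ -Colorability}}(n,\epsilon) = O\left(\frac{kq^3}{\epsilon}\,\ln^2\!\left(\frac{kq}{\epsilon}\right)\right).$$ That is, there is an absolute constant $K$ such that for all integers $q\ge 2$, $k\ge 1$, $n\ge 1$ and all $0<\epsilon<1$, there is a canonical $\epsilon$-tester for $k$-colorability of $q$-uniform hypergraphs on $n$ vertices whose sample complexity is at most $K\,\frac{kq^3}{\epsilon}\ln^2(kq/\epsilon)$.
   Context: A $q$-uniform hypergraph $H=(V,E)$ has edges that are sets of $q$ distinct vertices. It is $k$-colorable if its vertices can be colored with $k$ colors so that no edge has all its vertices of the same color. $(q,k)$-Colorability is the property of being a $k$-colorable $q$-uniform hypergraph. $H$ on $n$ vertices is $\epsilon$-far from this property if at least $\epsilon\binom{n}{q}$ edges need to be added or removed (equivalently, removed) to make it $k$-colorable. For $U\subseteq V$, $H[U]$ is the hypergraph with vertex set $U$ and all edges of $H$ contained in $U$. A canonical tester with sample complexity $s$ samples a uniformly random set $S$ of $s$ vertices (all vertices, if $s\ge n$) and accepts if and only if $H[S]$ satisfies some fixed predicate. It is an $\epsilon$-tester for a property if, for absolute constants $0\le c_0<c_1\le 1$, it accepts every input having the property with probability at least $c_1$ and accepts every input that is $\epsilon$-far from the property with probability at most $c_0$. $\mathcal{S}_{(q,k)\text{ -Colorability}}(n,\epsilon)$ is the minimum sample complexity of a canonical $\epsilon$-tester for $(q,k)$-Colorability on hypergraphs over $n$ vertices.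
   Formalization: A hypergraph counts as ε-far only if it is also not k-colorable; this is automatic when n ≥ q, but when n < q the stated definition makes the edgeless hypergraph both k-colorable and ε-far, so no tester could exist. -}

module Defs where

open import Data.Bool.Base using (Bool; T; _∧_; _xor_)
open import Data.Fin.Base using (Fin)
open import Data.Fin.Subset using (Subset; _∈_; ∣_∣; inside; outside)
import Data.Integer.Base as ℤ
open import Data.List.Base using (List; []; _∷_; _++_; map; length; filterᵇ)
open import Data.Nat.Base as ℕ using (ℕ; zero; suc; _⊓_; z≤n; s≤s)
open import Data.Nat.Combinatorics using (_C_; nCk+nC[k+1]≡[n+1]C[k+1])
import Data.Nat.Properties as ℕ
open import Data.Product.Base using (∃; _×_)
open import Data.Rational.Base using (ℚ; 0ℚ; 1ℚ; _+_; _*_; _/_; _<_; _≤_)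
open import Data.Sum.Base using (_⊎_)
open import Data.Vec.Base using ([]; _∷_)
open import Relation.Binary.PropositionalEquality using (_≡_; refl; sym; cong; trans)
open import Relation.Nullary using (¬_)

private
  variable
    n q : ℕ

fromℕ : ℕ → ℚ
fromℕ m = ℤ.+ m / 1

-- Dedekind reals, with existence and locatedness as data.

record ℝ : Set₁ where
  field
    lower         : ℚ → Set
    upper         : ℚ → Set
    lower-inhab   : ∃ λ a → lower a
    upper-inhab   : ∃ λ b → upper b
    lower-closed  : ∀ {a b} → a < b → lower b → lower a
    lower-rounded : ∀ {a} → lower a → ∃ λ b → a < b × lower b
    upper-closed  : ∀ {a b} → a < b → upper a → upper b
    upper-rounded : ∀ {b} → upper b → ∃ λ a → a < b × upper a
    disjoint      : ∀ {a} → lower a → ¬ upper a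
    located       : ∀ {a b} → a < b → lower a ⊎ upper b

open ℝ public

-- A real used only as an upper bound is given by its upper cut: the rationals
-- strictly above it.  The operations below give the right cut in the stated
-- ranges only.

UpperReal : Set₁
UpperReal = ℚ → Set

infix  4 _≤ᵘ_
infixl 7 _÷ᵘ_ _·ᵘ_
infixr 8 _²

_≤ᵘ_ : ℕ → UpperReal → Set
m ≤ᵘ x = ∀ b → x b → fromℕ m ≤ b

-- a / r for r > 0:  b > a / r  iff  b e > a for some rational 0 < e < r.
_÷ᵘ_ : ℕ → ℝ → UpperReal
(a ÷ᵘ r) b = ∃ λ e → 0ℚ < e × lower r e × fromℕ a < b * e

-- x y for x , y ≥ 0.
_·ᵘ_ : UpperReal → UpperReal → UpperReal
(x ·ᵘ y) b = ∃ λ c → ∃ λ d → x c × y d × c * d < b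

_² : UpperReal → UpperReal
x ² = x ·ᵘ x

-- ℓ ^ m / m !
expTerm : ℕ → ℚ → ℚ
expTerm zero    ℓ = 1ℚ
expTerm (suc m) ℓ = expTerm m ℓ * ℓ * (ℤ.+ 1 / suc m)

expSum : ℕ → ℚ → ℚ
expSum zero    ℓ = expTerm zero ℓ
expSum (suc m) ℓ = expSum m ℓ + expTerm (suc m) ℓ

-- ln x for x ≥ 1:  ℓ > ln x  iff  ℓ > 0 and exp ℓ > x.  For ℓ > 0 the partial
-- sums of the exponential series increase to exp ℓ, so the latter holds iff
-- some partial sum exceeds x.
lnᵘ : UpperReal → UpperReal
lnᵘ x ℓ = 0ℚ < ℓ × ∃ λ m → x (expSum m ℓ)

subsets : ∀ n → List (Subset n)
subsets zero    = [] ∷ []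
subsets (suc n) = map (outside ∷_) (subsets n) ++ map (inside ∷_) (subsets n)

#subsets : (Subset n → Bool) → ℕ
#subsets {n} p = length (filterᵇ p (subsets n))

record Hypergraph (q n : ℕ) : Set where
  field
    edge?   : Subset n → Bool
    uniform : ∀ e → T (edge? e) → ∣ e ∣ ≡ q

open Hypergraph public

Monochromatic : ∀ {k} → (Fin n → Fin k) → Subset n → Set
Monochromatic c e = ∀ u v → u ∈ e → v ∈ e → c u ≡ c v

Colorable : ℕ → Hypergraph q n → Set
Colorable {n = n} k H =
  ∃ λ (c : Fin n → Fin k) → ∀ e → T (edge? H e) → ¬ Monochromatic c e

distance : Hypergraph q n → Hypergraph q n → ℕ
distance H H′ = #subsets λ e → edge? H e xor edge? H′ e

-- The first component matters only when n < q: then n C q = 0, and without it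
-- the (colorable) empty hypergraph would count as far.  When q ≤ n and ε > 0
-- it follows from the second.
Far : ℕ → ℝ → Hypergraph q n → Set
Far {q} {n} k ε H =
  ¬ Colorable k H ×
  (∀ (H′ : Hypergraph q n) → Colorable k H′ →
   ∀ e → lower ε e → e * fromℕ (n C q) ≤ fromℕ (distance H H′))

-- The image of a subset of Fin ∣ S ∣ under the increasing bijection from
-- Fin ∣ S ∣ onto S.
expand : (S : Subset n) → Subset ∣ S ∣ → Subset n
expand []            _       = []
expand (outside ∷ S) U       = outside ∷ expand S U
expand (inside  ∷ S) (b ∷ U) = b ∷ expand S U

∣expand∣ : (S : Subset n) (U : Subset ∣ S ∣) → ∣ expand S U ∣ ≡ ∣ U ∣
∣expand∣ []            []            = refl
∣expand∣ (outside ∷ S) U             = ∣expand∣ S U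
∣expand∣ (inside  ∷ S) (outside ∷ U) = ∣expand∣ S U
∣expand∣ (inside  ∷ S) (inside  ∷ U) = cong suc (∣expand∣ S U)

-- H[S], with its vertex set S identified with Fin ∣ S ∣.
induced : Hypergraph q n → (S : Subset n) → Hypergraph q ∣ S ∣
induced H S = record
  { edge?   = λ U → edge? H (expand S U)
  ; uniform = λ U p → trans (sym (∣expand∣ S U)) (uniform H (expand S U) p)
  }

record CanonicalTester (q : ℕ) : Set where
  field
    sampleSize : ℕ
    accepts?   : ∀ {m} → Hypergraph q m → Bool

open CanonicalTester public

C-nonZero : ∀ {n k} → k ℕ.≤ n → ℕ.NonZero (n C k)
C-nonZero {n} {k} k≤n = ℕ.>-nonZero (positive k≤n)
  where
  positive : ∀ {n k} → k ℕ.≤ n → 0 ℕ.< n C k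
  positive {n} z≤n = s≤s z≤n
  positive {suc n} {suc k} (s≤s k≤n) =
    ℕ.<-≤-trans (positive k≤n)
      (ℕ.≤-trans (ℕ.m≤m+n (n C k) (n C suc k))
                 (ℕ.≤-reflexive (nCk+nC[k+1]≡[n+1]C[k+1] n k)))

-- The sample is a uniformly random set of min (sampleSize , n) vertices.
acceptProbability : CanonicalTester q → Hypergraph q n → ℚ
acceptProbability {n = n} A H = ℤ.+ accepting / (n C s)
  where
  s = sampleSize A ⊓ n
  accepting = #subsets λ S → (∣ S ∣ ℕ.≡ᵇ s) ∧ accepts? A (induced H S)
  instance
    nonZero : ℕ.NonZero (n C s)
    nonZero = C-nonZero (ℕ.m⊓n≤n (sampleSize A) n)

-- A is an ε-tester for k-colorability of q-uniform hypergraphs on n vertices.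
IsTester : (c₀ c₁ : ℚ) (k n : ℕ) → ℝ → CanonicalTester q → Set
IsTester {q} c₀ c₁ k n ε A =
  (∀ (H : Hypergraph q n) → Colorable k H → c₁ ≤ acceptProbability A H) ×
  (∀ (H : Hypergraph q n) → Far k ε H → acceptProbability A H ≤ c₀)

{-# OPTIONS --safe #-}
-- Colour a sample S and identify the colouring χ by asking adaptively whether
-- a chosen vertex v lies in S with colour c.  A state records the colours still
-- possible for every vertex.  While some pair (v , c) has high degree in the
-- hypergraph of possible vertices of colour c, positive answers build up a part
-- A of an edge, chosen so that the proportion of edges extending A does not
-- drop; as no edge within S is monochromatic, negative answers must use up this
-- proportion.  Hence after t positive answers with degree thresholds at least
-- C(n-1, q-1) / 2^i, some n t / (q² 2^i) of the k n pairs (v , c) have been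
-- queried, so t ≤ k q² 2^i.
--
-- Were the set of vertices left without a colour small at every threshold, one
-- could colour each such vertex by a colour it had at the preceding threshold,
-- and few edges would be monochromatic, contrary to H being far from colorable.
-- So at some threshold n (t + 1) ≤ a |M| for a set M that S avoids, with
-- a = O(k q³ m Λ), where 1/m approximates ε and 2^Λ approximates k q m.
-- Summing over the decision tree, the proportion of accepted samples of size
-- 2 a L with L = O(Λ) is at most 1/2.
module Submission where

open import Defs
open import Data.Bool.Base using (Bool; true; false; T; not; _∧_; _xor_; if_then_else_)
open import Data.Bool.Properties using (T?; T-∧)
open import Data.Empty using (⊥; ⊥-elim)
open import Data.Fin.Base using (Fin; zero; suc)
import Data.Fin.Properties as Fin
open import Data.Fin.Subset using (Subset; ∣_∣; inside; outside; _∈_)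
open import Data.Fin.Subset.Properties using (anySubset?; _∈?_)
import Data.Integer.Base as ℤ
import Data.Integer.Properties as ℤ
open import Data.List.Base using (List; []; _∷_; _++_; map; length; filterᵇ)
open import Data.Nat.Base as ℕ using (ℕ; zero; suc; _+_; _*_; _∸_; _⊓_; _^_; _≤_; _<_; z≤n; s≤s; NonZero)
open import Data.Nat.Combinatorics using (_C_; nCk+nC[k+1]≡[n+1]C[k+1])
open import Data.Nat.Induction using (<-rec)
open import Data.Nat.Properties
open import Data.Nat.Tactic.RingSolver using (solve-∀)
open import Data.Product.Base using (∃; _×_; _,_; proj₁; proj₂)
open import Data.Rational.Base as ℚ using (ℚ; 0ℚ; 1ℚ; ½; toℚᵘ)
import Data.Rational.Properties as ℚ
import Data.Rational.Solver as ℚ-Solver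
open import Data.Rational.Unnormalised.Base as ℚᵘ using (mkℚᵘ; *≡*; *≤*; *<*)
import Data.Rational.Unnormalised.Properties as ℚᵘ
open import Data.Sum.Base using (_⊎_; inj₁; inj₂)
open import Data.Unit.Base using (tt)
open import Data.Vec.Base using (Vec; []; _∷_; lookup; tabulate)
open import Data.Vec.Properties using ([]=⇒lookup; lookup⇒[]=; lookup∘tabulate)
open import Function.Base using (_∘_)
open import Function.Bundles using (Equivalence)
open import Relation.Binary.Definitions using (tri<; tri≈; tri>)
open import Relation.Binary.PropositionalEquality
open import Relation.Nullary using (¬_; yes; no; Dec; does)
open import Relation.Nullary.Decidable using (_×-dec_; ¬?; _→-dec_; map′; dec-true; dec-false)

-- A leaf reached by t positive answers has to be paid for about (k n)^t times, once for each choice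
-- of the pairs answered positively. The samples that contain the t vertices found are at most (s /
-- n)^t of all, so n cancels and (2 k s)^t remains. Avoiding M, which makes up at least (t + 1) / a
-- of the vertices, gains 2^((t + 1) L) for samples of size s = 2 a L. With 2 k s ≤ 2^L this absorbs
-- (2 k s)^t and leaves a spare factor 2^L. This is why M must grow linearly with t. One fixed
-- degree threshold would not do: a low threshold permits many positive answers and so leaves M
-- undetected up to a large size, while the degrees at its vertices may still be as large as D,
-- which would cost a further factor of order q / ε in a. With thresholds halved step by step, at
-- scale i the size of M that goes undetected grows like 2^i, but the degrees in force there are at
-- most 2 D / 2^i. Every scale therefore spoils at most the same number B / a of edges, and only the
-- number of scales enters a. That number is the source of one logarithm; L is the source of the
-- other.

private
  variable
    n r l : ℕ
    E : Set

-- Finite sums and counts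

∧-intro : ∀ {a b} → T a → T b → T (a ∧ b)
∧-intro x y = Equivalence.from T-∧ (x , y)

∧-elim : ∀ {a b} → T (a ∧ b) → T a × T b
∧-elim = Equivalence.to T-∧

not-intro : ∀ {a} → ¬ T a → T (not a)
not-intro {true}  ¬a = ¬a tt
not-intro {false} _  = tt

not-elim : ∀ {a} → T (not a) → ¬ T a
not-elim {false} _ ()

does-elim : {P : Set} (P? : Dec P) → T (does P?) → P
does-elim (yes p) _ = p

does-intro : {P : Set} (P? : Dec P) → P → T (does P?)
does-intro (yes _) _ = tt
does-intro (no ¬p) p = ¬p p

ind : Bool → ℕ
ind b = if b then 1 else 0

ind-true : ∀ {b} → T b → ind b ≡ 1
ind-true {true} _ = refl

ind-false : ∀ {b} → ¬ T b → ind b ≡ 0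
ind-false {true}  ¬t = ⊥-elim (¬t tt)
ind-false {false} _  = refl

ind-mono : ∀ {a b} → (T a → T b) → ind a ≤ ind b
ind-mono {false}        _ = z≤n
ind-mono {true} {true}  _ = ≤-refl
ind-mono {true} {false} f = ⊥-elim (f tt)

interchange : ∀ a b c d → (a + b) + (c + d) ≡ (a + c) + (b + d)
interchange = solve-∀

∑ : (Fin n → ℕ) → ℕ
∑ {zero}  f = 0
∑ {suc n} f = f zero + ∑ (f ∘ suc)

∑-mono : {f g : Fin n → ℕ} → (∀ v → f v ≤ g v) → ∑ f ≤ ∑ g
∑-mono {zero}  h = z≤n
∑-mono {suc n} h = +-mono-≤ (h zero) (∑-mono (h ∘ suc))

∑-cong : {f g : Fin n → ℕ} → (∀ v → f v ≡ g v) → ∑ f ≡ ∑ g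
∑-cong h = ≤-antisym (∑-mono (≤-reflexive ∘ h)) (∑-mono (≤-reflexive ∘ sym ∘ h))

∑-mono-< : {f g : Fin n → ℕ} → (∀ v → f v ≤ g v) → ∀ v → f v < g v → ∑ f < ∑ g
∑-mono-< h zero    lt = +-mono-<-≤ lt (∑-mono (h ∘ suc))
∑-mono-< h (suc v) lt = +-mono-≤-< (h zero) (∑-mono-< (h ∘ suc) v lt)

∑-+ : (f g : Fin n → ℕ) → ∑ (λ v → f v + g v) ≡ ∑ f + ∑ g
∑-+ {zero}  f g = refl
∑-+ {suc n} f g = trans (cong (f zero + g zero +_) (∑-+ (f ∘ suc) (g ∘ suc)))
                        (interchange (f zero) (g zero) (∑ (f ∘ suc)) (∑ (g ∘ suc)))

∑-*ˡ : ∀ c (f : Fin n → ℕ) → ∑ (λ v → c * f v) ≡ c * ∑ f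
∑-*ˡ {zero}  c f = sym (*-zeroʳ c)
∑-*ˡ {suc n} c f = trans (cong (c * f zero +_) (∑-*ˡ c (f ∘ suc)))
                         (sym (*-distribˡ-+ c (f zero) (∑ (f ∘ suc))))

∑-const : ∀ n c → ∑ {n} (λ _ → c) ≡ n * c
∑-const zero    c = refl
∑-const (suc n) c = cong (c +_) (∑-const n c)

≤-∑ : (f : Fin n → ℕ) → ∀ v → f v ≤ ∑ f
≤-∑ f zero    = m≤m+n _ _
≤-∑ f (suc v) = ≤-trans (≤-∑ (f ∘ suc) v) (m≤n+m _ _)

∑-suc-at : {f g : Fin n → ℕ} → ∀ v → g v ≡ suc (f v) →
           (∀ u → u ≢ v → g u ≡ f u) → ∑ g ≡ suc (∑ f)
∑-suc-at {f = f} zero    e h =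
  cong₂ _+_ e (∑-cong λ u → h (suc u) λ ())
∑-suc-at {f = f} (suc v) e h =
  trans (cong₂ _+_ (h zero λ ())
                   (∑-suc-at v e λ u u≢v → h (suc u) (u≢v ∘ Fin.suc-injective)))
        (+-suc (f zero) _)

∑-complement : (B : Fin n → Bool) → ∑ (ind ∘ not ∘ B) + ∑ (ind ∘ B) ≡ n
∑-complement {n} B = begin
  ∑ (ind ∘ not ∘ B) + ∑ (ind ∘ B)      ≡⟨ ∑-+ (ind ∘ not ∘ B) (ind ∘ B) ⟨
  ∑ (λ v → ind (not (B v)) + ind (B v)) ≡⟨ ∑-cong (λ v → one (B v)) ⟩
  ∑ {n} (λ _ → 1)                       ≡⟨ ∑-const n 1 ⟩
  n * 1                                 ≡⟨ *-identityʳ n ⟩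
  n                                     ∎
  where
  open ≡-Reasoning
  one : ∀ b → ind (not b) + ind b ≡ 1
  one true  = refl
  one false = refl

∣_∣≡∑ : (S : Subset n) → ∣ S ∣ ≡ ∑ (ind ∘ lookup S)
∣ [] ∣≡∑          = refl
∣ inside ∷ S ∣≡∑  = cong suc ∣ S ∣≡∑
∣ outside ∷ S ∣≡∑ = ∣ S ∣≡∑

-- Averaging with cleared denominators: if `f v` were below y / (x + 1) throughout `B`, then (x + 1)
-- f v + 1 ≤ y there, and summing over the x + 1 elements of `B` gives a contradiction.
weighted-average : (B : Fin n → Bool) (f : Fin n → ℕ) → ∀ x y →
  suc x ≡ ∑ (ind ∘ B) → y ≤ ∑ (λ v → ind (B v) * f v) →
  ∃ λ v → T (B v) × y ≤ suc x * f v
weighted-average B f x y eq le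
  with Fin.any? (λ v → T? (B v) ×-dec (y ≤? suc x * f v))
... | yes found = found
... | no  none  = ⊥-elim (<-irrefl refl (begin-strict
    suc x * y                                         ≤⟨ *-monoʳ-≤ (suc x) le ⟩
    suc x * ∑ (λ v → ind (B v) * f v)                 <⟨ m<m+n _ (s≤s z≤n) ⟩
    suc x * ∑ (λ v → ind (B v) * f v) + suc x
      ≡⟨ cong₂ _+_ (sym (∑-*ˡ (suc x) (λ v → ind (B v) * f v))) eq ⟩
    ∑ (λ v → suc x * (ind (B v) * f v)) + ∑ (ind ∘ B) ≡⟨ ∑-+ (λ v → suc x * (ind (B v) * f v)) (ind ∘ B) ⟨
    ∑ (λ v → suc x * (ind (B v) * f v) + ind (B v))   ≤⟨ ∑-mono small ⟩
    ∑ (λ v → y * ind (B v))                           ≡⟨ ∑-*ˡ y (ind ∘ B) ⟩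
    y * ∑ (ind ∘ B)                                   ≡⟨ cong (y *_) eq ⟨
    y * suc x                                         ≡⟨ *-comm y (suc x) ⟩
    suc x * y                                         ∎))
  where
  open ≤-Reasoning
  small : ∀ v → suc x * (ind (B v) * f v) + ind (B v) ≤ y * ind (B v)
  small v with B v in Bv
  ... | false rewrite *-zeroʳ x | *-zeroʳ y = z≤n
  ... | true  rewrite +-identityʳ (f v) | *-identityʳ y | +-comm (suc x * f v) 1 =
    ≰⇒> λ y≤ → none (v , subst T (sym Bv) tt , y≤)

cnt : (E → Bool) → List E → ℕ
cnt p xs = length (filterᵇ p xs)

cnt-∷ : ∀ (p : E → Bool) x xs → cnt p (x ∷ xs) ≡ ind (p x) + cnt p xs
cnt-∷ p x xs with p x
... | true  = refl
... | false = refl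

cnt-mono : {p r : E → Bool} → (∀ x → T (p x) → T (r x)) → ∀ xs → cnt p xs ≤ cnt r xs
cnt-mono h []       = z≤n
cnt-mono {p = p} {r} h (x ∷ xs) rewrite cnt-∷ p x xs | cnt-∷ r x xs =
  +-mono-≤ (ind-mono (h x)) (cnt-mono h xs)

cnt-⊎ : {p r t : E → Bool} → (∀ x → T (p x) → T (r x) ⊎ T (t x)) →
        ∀ xs → cnt p xs ≤ cnt r xs + cnt t xs
cnt-⊎ h []       = z≤n
cnt-⊎ {p = p} {r} {t} h (x ∷ xs) rewrite cnt-∷ p x xs | cnt-∷ r x xs | cnt-∷ t x xs =
  ≤-trans (+-mono-≤ (split (p x) (r x) (t x) (h x)) (cnt-⊎ h xs))
          (≤-reflexive (interchange (ind (r x)) (ind (t x)) (cnt r xs) (cnt t xs)))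
  where
  split : ∀ a b c → (T a → T b ⊎ T c) → ind a ≤ ind b + ind c
  split false b     c     h = z≤n
  split true  true  c     h = s≤s z≤n
  split true  false true  h = ≤-refl
  split true  false false h with h tt
  ... | inj₁ ()
  ... | inj₂ ()

-- Double counting of the pairs (v , x) with `p x` and `r v x`.
cnt-∑ : ∀ c (p : E → Bool) (r : Fin n → E → Bool) →
        (∀ x → T (p x) → c ≤ ∑ (λ v → ind (r v x))) →
        ∀ xs → c * cnt p xs ≤ ∑ (λ v → cnt (λ x → p x ∧ r v x) xs)
cnt-∑ c p r h []       = ≤-trans (≤-reflexive (*-zeroʳ c)) z≤n
cnt-∑ c p r h (x ∷ xs) = begin
  c * cnt p (x ∷ xs)                     ≡⟨ cong (c *_) (cnt-∷ p x xs) ⟩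
  c * (ind (p x) + cnt p xs)             ≡⟨ *-distribˡ-+ c (ind (p x)) (cnt p xs) ⟩
  c * ind (p x) + c * cnt p xs           ≤⟨ +-mono-≤ (head (p x) (h x)) (cnt-∑ c p r h xs) ⟩
  ∑ (λ v → ind (p x ∧ r v x)) + ∑ (λ v → cnt (λ x → p x ∧ r v x) xs)
                                         ≡⟨ ∑-+ (λ v → ind (p x ∧ r v x)) _ ⟨
  ∑ (λ v → ind (p x ∧ r v x) + cnt (λ x → p x ∧ r v x) xs)
                                         ≡⟨ ∑-cong (λ v → sym (cnt-∷ (λ x → p x ∧ r v x) x xs)) ⟩
  ∑ (λ v → cnt (λ x → p x ∧ r v x) (x ∷ xs)) ∎
  where
  open ≤-Reasoning
  head : ∀ b → (T b → c ≤ ∑ (λ v → ind (r v x))) → c * ind b ≤ ∑ (λ v → ind (b ∧ r v x))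
  head false _ = ≤-trans (≤-reflexive (*-zeroʳ c)) z≤n
  head true  f = ≤-trans (≤-reflexive (*-identityʳ c)) (f tt)

cnt-none : {p : E → Bool} → (∀ x → ¬ T (p x)) → ∀ xs → cnt p xs ≡ 0
cnt-none h xs = n≤0⇒n≡0 (≤-trans (cnt-mono {r = λ _ → false} (λ x → ⊥-elim ∘ h x) xs)
                                 (≤-reflexive (none xs)))
  where
  none : (xs : List E) → cnt (λ _ → false) xs ≡ 0
  none []       = refl
  none (x ∷ xs) = none xs

cnt-witness : ∀ (p : E → Bool) xs → 0 < cnt p xs → ∃ λ x → T (p x)
cnt-witness p (x ∷ xs) lt with p x in eq
... | true  = x , subst T (sym eq) tt
... | false = cnt-witness p xs lt

cnt-++ : ∀ (p : E → Bool) xs ys → cnt p (xs ++ ys) ≡ cnt p xs + cnt p ys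
cnt-++ p []       ys = refl
cnt-++ p (x ∷ xs) ys rewrite cnt-∷ p x (xs ++ ys) | cnt-∷ p x xs | cnt-++ p xs ys =
  sym (+-assoc (ind (p x)) _ _)

cnt-map : ∀ {Y : Set} (p : E → Bool) (f : Y → E) ys → cnt p (map f ys) ≡ cnt (p ∘ f) ys
cnt-map p f []       = refl
cnt-map p f (y ∷ ys) rewrite cnt-∷ p (f y) (map f ys) | cnt-∷ (p ∘ f) y ys =
  cong (ind (p (f y)) +_) (cnt-map p f ys)

#subsets-suc : (p : Subset (suc n) → Bool) →
  #subsets p ≡ #subsets (p ∘ (outside ∷_)) + #subsets (p ∘ (inside ∷_))
#subsets-suc {n} p =
  trans (cnt-++ p (map (outside ∷_) (subsets n)) (map (inside ∷_) (subsets n)))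
        (cong₂ _+_ (cnt-map p (outside ∷_) (subsets n)) (cnt-map p (inside ∷_) (subsets n)))

#subsets-none : (p : Subset n → Bool) → (∀ S → ¬ T (p S)) → #subsets p ≡ 0
#subsets-none {n} p h = cnt-none h (subsets n)

free : (F M : Fin n → Bool) → ℕ
free F M = ∑ (λ v → ind (not (F v) ∧ not (M v)))

-- Such a set is determined by its u elements outside both `F` and `M`.
#subsets-between : (F M : Fin n → Bool) → ∀ u (p : Subset n → Bool) →
  (∀ S → T (p S) → ∣ S ∣ ≡ ∑ (ind ∘ F) + u) →
  (∀ S → T (p S) → ∀ v → T (F v) → T (lookup S v)) →
  (∀ S → T (p S) → ∀ v → T (M v) → ¬ T (lookup S v)) →
  #subsets p ≤ free F M C u
#subsets-between {zero} F M u p size ⊇F ∌M with p [] in eq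
... | false = z≤n
... | true  rewrite sym (size [] (subst T (sym eq) tt)) = ≤-refl
#subsets-between {suc n} F M u p size ⊇F ∌M
  rewrite #subsets-suc p with F zero in F0 | M zero in M0
... | true | b =
  +-mono-≤ (≤-reflexive (#subsets-none (p ∘ (outside ∷_)) λ S pS → ⊇F _ pS zero (subst T (sym F0) tt)))
           (#subsets-between (F ∘ suc) (M ∘ suc) u (p ∘ (inside ∷_))
             (λ S pS → suc-injective (size _ pS))
             (λ S pS v → ⊇F _ pS (suc v)) (λ S pS v → ∌M _ pS (suc v)))
... | false | true =
  ≤-trans (+-mono-≤ (#subsets-between (F ∘ suc) (M ∘ suc) u (p ∘ (outside ∷_))
                      (λ S pS → size _ pS)
                      (λ S pS v → ⊇F _ pS (suc v)) (λ S pS v → ∌M _ pS (suc v)))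
                    (≤-reflexive (#subsets-none (p ∘ (inside ∷_)) λ S pS → ∌M _ pS zero (subst T (sym M0) tt) tt)))
          (≤-reflexive (+-identityʳ _))
... | false | false with u
...   | zero =
  ≤-trans (+-mono-≤ (#subsets-between (F ∘ suc) (M ∘ suc) 0 (p ∘ (outside ∷_))
                      (λ S pS → size _ pS)
                      (λ S pS v → ⊇F _ pS (suc v)) (λ S pS v → ∌M _ pS (suc v)))
                    -- For u = 0 the set has room for `F` only, so it cannot contain the free vertex
                    -- `zero`.
                    (≤-reflexive (#subsets-none (p ∘ (inside ∷_)) λ S pS → <-irrefl refl (begin-strict
                       ∑ (ind ∘ F ∘ suc)     ≤⟨ ∑-mono (λ v → ind-mono {b = lookup S v} (⊇F _ pS (suc v))) ⟩
                       ∑ (ind ∘ lookup S)    ≡⟨ ∣ S ∣≡∑ ⟨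
                       ∣ S ∣                 <⟨ ≤-refl ⟩
                       suc ∣ S ∣             ≡⟨ size _ pS ⟩
                       ∑ (ind ∘ F ∘ suc) + 0 ≡⟨ +-identityʳ _ ⟩
                       ∑ (ind ∘ F ∘ suc)     ∎))))
          (≤-reflexive (+-identityʳ _))
  where open ≤-Reasoning
...   | suc u′ =
  ≤-trans (+-mono-≤ (#subsets-between (F ∘ suc) (M ∘ suc) (suc u′) (p ∘ (outside ∷_))
                      (λ S pS → size _ pS)
                      (λ S pS v → ⊇F _ pS (suc v)) (λ S pS v → ∌M _ pS (suc v)))
                    (#subsets-between (F ∘ suc) (M ∘ suc) u′ (p ∘ (inside ∷_))
                      (λ S pS → suc-injective (trans (size _ pS) (+-suc _ u′)))
                      (λ S pS v → ⊇F _ pS (suc v)) (λ S pS v → ∌M _ pS (suc v))))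
          (≤-reflexive (trans (+-comm (free (F ∘ suc) (M ∘ suc) C suc u′) _)
                              (nCk+nC[k+1]≡[n+1]C[k+1] (free (F ∘ suc) (M ∘ suc)) u′)))

#subsets-of-size : ∀ n s (p : Subset n → Bool) →
  (∀ S → ∣ S ∣ ≡ s → T (p S)) → n C s ≤ #subsets p
#subsets-of-size zero zero    p h with p [] | h [] refl
... | true | _ = ≤-refl
#subsets-of-size zero (suc s) p h = z≤n
#subsets-of-size (suc n) zero p h = begin
  n C 0                     ≤⟨ #subsets-of-size n 0 (p ∘ (outside ∷_)) (λ S → h (outside ∷ S)) ⟩
  #subsets (p ∘ (outside ∷_)) ≤⟨ m≤m+n _ _ ⟩
  _                         ≡⟨ #subsets-suc p ⟨
  #subsets p                ∎
  where open ≤-Reasoning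
#subsets-of-size (suc n) (suc s) p h = begin
  suc n C suc s             ≡⟨ nCk+nC[k+1]≡[n+1]C[k+1] n s ⟨
  n C s + n C suc s         ≡⟨ +-comm (n C s) _ ⟩
  n C suc s + n C s
    ≤⟨ +-mono-≤ (#subsets-of-size n (suc s) (p ∘ (outside ∷_)) (λ S → h (outside ∷ S)))
                (#subsets-of-size n s (p ∘ (inside ∷_)) (λ S e → h (inside ∷ S) (cong suc e))) ⟩
  _                         ≡⟨ #subsets-suc p ⟨
  #subsets p                ∎
  where open ≤-Reasoning

-- Binomial coefficients and powers

C-absorb : ∀ n k → suc k * (suc n C suc k) ≡ suc n * (n C k)
C-absorb zero zero = refl
C-absorb zero (suc k) = *-zeroʳ k
C-absorb (suc n) zero = begin
  1 * (suc (suc n) C 1)            ≡⟨ cong (1 *_) (nCk+nC[k+1]≡[n+1]C[k+1] (suc n) 0) ⟨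
  1 * (1 + suc n C 1)              ≡⟨ *-distribˡ-+ 1 1 (suc n C 1) ⟩
  1 + 1 * (suc n C 1)              ≡⟨ cong suc (C-absorb n 0) ⟩
  1 + suc n * 1                    ≡⟨⟩
  suc (suc n) * 1                  ∎
  where open ≡-Reasoning
C-absorb (suc n) (suc k) = begin
  suc (suc k) * (suc (suc n) C suc (suc k))
    ≡⟨ cong (suc (suc k) *_) (nCk+nC[k+1]≡[n+1]C[k+1] (suc n) (suc k)) ⟨
  suc (suc k) * (a + b)
    ≡⟨ regroup a b k ⟩
  a + suc k * a + suc (suc k) * b
    ≡⟨ cong₂ (λ x y → a + x + y) (C-absorb n k) (C-absorb n (suc k)) ⟩
  a + suc n * (n C k) + suc n * (n C suc k)
    ≡⟨ +-assoc a _ _ ⟩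
  a + (suc n * (n C k) + suc n * (n C suc k))
    ≡⟨ cong (a +_) (*-distribˡ-+ (suc n) (n C k) (n C suc k)) ⟨
  a + suc n * (n C k + n C suc k)
    ≡⟨ cong (λ x → a + suc n * x) (nCk+nC[k+1]≡[n+1]C[k+1] n k) ⟩
  suc (suc n) * a ∎
  where
  open ≡-Reasoning
  a = suc n C suc k
  b = suc n C suc (suc k)
  regroup : ∀ a b k → suc (suc k) * (a + b) ≡ a + suc k * a + suc (suc k) * b
  regroup = solve-∀

C-zero : ∀ {n k} → n < k → n C k ≡ 0
C-zero {zero}  {suc k} _ = refl
C-zero {suc n} {suc k} (s≤s lt) =
  trans (sym (nCk+nC[k+1]≡[n+1]C[k+1] n k)) (cong₂ _+_ (C-zero lt) (C-zero (m≤n⇒m≤1+n lt)))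

C-absorbʳ : ∀ n k → suc k * (n C suc k) ≡ (n ∸ k) * (n C k)
C-absorbʳ n k with k ≤? n
... | no k≰n = trans (cong (suc k *_) (C-zero (m≤n⇒m≤1+n (≰⇒> k≰n))))
                     (trans (*-zeroʳ (suc k)) (sym (cong (_* (n C k)) (m≤n⇒m∸n≡0 (<⇒≤ (≰⇒> k≰n))))))
... | yes k≤n = +-cancelˡ-≡ (suc k * (n C k)) _ _ (begin
  suc k * (n C k) + suc k * (n C suc k)   ≡⟨ *-distribˡ-+ (suc k) (n C k) _ ⟨
  suc k * (n C k + n C suc k)             ≡⟨ cong (suc k *_) (nCk+nC[k+1]≡[n+1]C[k+1] n k) ⟩
  suc k * (suc n C suc k)                 ≡⟨ C-absorb n k ⟩
  suc n * (n C k)                         ≡⟨ cong (λ x → suc x * (n C k)) (m+[n∸m]≡n k≤n) ⟨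
  suc (k + (n ∸ k)) * (n C k)             ≡⟨ *-distribʳ-+ (n C k) (suc k) (n ∸ k) ⟩
  suc k * (n C k) + (n ∸ k) * (n C k)     ∎)
  where open ≡-Reasoning

-- Telescoping: C(t + N, t + r) / C(N, r) is the product of (i + 1 + N) / (i + 1 + r) over i < t,
-- and each factor is at least A / B.
C-diagonal : ∀ A B N r t → (∀ i → i < t → A * suc (i + r) ≤ B * suc (i + N)) →
             (N C r) * A ^ t ≤ B ^ t * ((t + N) C (t + r))
C-diagonal A B N r zero    h = ≤-reflexive (trans (*-identityʳ _) (sym (*-identityˡ _)))
C-diagonal A B N r (suc t) h = *-cancelˡ-≤ (suc (t + N)) (begin
  suc (t + N) * ((N C r) * (A * A ^ t))            ≡⟨ e₁ (suc (t + N)) (N C r) A (A ^ t) ⟩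
  suc (t + N) * A * ((N C r) * A ^ t)
    ≤⟨ *-monoʳ-≤ (suc (t + N) * A) (C-diagonal A B N r t λ i i<t → h i (m≤n⇒m≤1+n i<t)) ⟩
  suc (t + N) * A * (B ^ t * ((t + N) C (t + r)))  ≡⟨ e₂ (suc (t + N)) A (B ^ t) ((t + N) C (t + r)) ⟩
  A * B ^ t * (suc (t + N) * ((t + N) C (t + r)))  ≡⟨ cong (A * B ^ t *_) (C-absorb (t + N) (t + r)) ⟨
  A * B ^ t * (suc (t + r) * c)                    ≡⟨ e₃ A (B ^ t) (suc (t + r)) c ⟩
  A * suc (t + r) * (B ^ t * c)                    ≤⟨ *-monoˡ-≤ (B ^ t * c) (h t ≤-refl) ⟩
  B * suc (t + N) * (B ^ t * c)                    ≡⟨ e₄ B (suc (t + N)) (B ^ t) c ⟩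
  suc (t + N) * (B * B ^ t * c)                    ∎)
  where
  open ≤-Reasoning
  c = suc (t + N) C suc (t + r)
  e₁ : ∀ a b c d → a * (b * (c * d)) ≡ a * c * (b * d)
  e₁ = solve-∀
  e₂ : ∀ a b c d → a * b * (c * d) ≡ b * c * (a * d)
  e₂ = solve-∀
  e₃ : ∀ a b c d → a * b * (c * d) ≡ a * c * (b * d)
  e₃ = solve-∀
  e₄ : ∀ a b c d → a * b * (c * d) ≡ b * (a * c * d)
  e₄ = solve-∀

-- Bounds the probability that a random (t + r)-subset of a (t + N)-set contains t given elements by
-- ((t + r) / (t + N))^t. Each factor (i + 1 + r) / (i + 1 + N) is at most the last one;
-- cross-multiplied, the two differ by (N - r) (t - i - 1).
C-subset-ratio : ∀ N r t → r ≤ N → (N C r) * (t + N) ^ t ≤ (t + r) ^ t * ((t + N) C (t + r))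
C-subset-ratio N r t r≤N = C-diagonal (t + N) (t + r) N r t λ i i<t →
  subst₂ (λ N′ t′ → (t′ + N′) * suc (i + r) ≤ (t′ + r) * suc (i + N′))
         (m+[n∸m]≡n r≤N) (m+[n∸m]≡n i<t)
         (≤-trans (m≤m+n _ _) (≤-reflexive (sym (difference i r (N ∸ r) (t ∸ suc i)))))
  where
  difference : ∀ i r x z → (suc i + z + r) * suc (i + (r + x)) ≡
               (suc i + z + (r + x)) * suc (i + r) + x * z
  difference = solve-∀

-- The probability that a random r-subset of an N-set stays within P given elements is the product
-- of (P - i) / (N - i), and no factor exceeds P / N.
C-avoid-ratio : ∀ P N r → P ≤ N → (P C r) * N ^ r ≤ P ^ r * (N C r)
C-avoid-ratio P N zero    P≤N = ≤-refl
C-avoid-ratio P N (suc r) P≤N = *-cancelˡ-≤ (suc r) (begin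
  suc r * ((P C suc r) * (N * N ^ r))     ≡⟨ e₁ (suc r) (P C suc r) N (N ^ r) ⟩
  suc r * (P C suc r) * (N * N ^ r)       ≡⟨ cong (_* (N * N ^ r)) (C-absorbʳ P r) ⟩
  (P ∸ r) * (P C r) * (N * N ^ r)         ≡⟨ e₂ (P ∸ r) (P C r) N (N ^ r) ⟩
  N * (P ∸ r) * ((P C r) * N ^ r)         ≤⟨ *-mono-≤ shrink (C-avoid-ratio P N r P≤N) ⟩
  P * (N ∸ r) * (P ^ r * (N C r))         ≡⟨ e₃ P (N ∸ r) (P ^ r) (N C r) ⟩
  P * P ^ r * ((N ∸ r) * (N C r))         ≡⟨ cong (P * P ^ r *_) (C-absorbʳ N r) ⟨
  P * P ^ r * (suc r * (N C suc r))       ≡⟨ e₄ (P * P ^ r) (suc r) (N C suc r) ⟩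
  suc r * (P * P ^ r * (N C suc r))       ∎)
  where
  open ≤-Reasoning
  e₁ : ∀ a b c d → a * (b * (c * d)) ≡ a * b * (c * d)
  e₁ = solve-∀
  e₂ : ∀ a b c d → a * b * (c * d) ≡ c * a * (b * d)
  e₂ = solve-∀
  e₃ : ∀ a b c d → a * b * (c * d) ≡ a * c * (b * d)
  e₃ = solve-∀
  e₄ : ∀ a b c → a * (b * c) ≡ b * (a * c)
  e₄ = solve-∀
  shrink : N * (P ∸ r) ≤ P * (N ∸ r)
  shrink = begin
    N * (P ∸ r)       ≡⟨ *-distribˡ-∸ N P r ⟩
    N * P ∸ N * r     ≤⟨ ∸-mono {N * P} ≤-refl (*-monoˡ-≤ r P≤N) ⟩
    N * P ∸ P * r     ≡⟨ cong (_∸ P * r) (*-comm N P) ⟩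
    P * N ∸ P * r     ≡⟨ *-distribˡ-∸ P N r ⟨
    P * (N ∸ r)       ∎

n<2^n : ∀ n → n < 2 ^ n
n<2^n zero    = s≤s z≤n
n<2^n (suc n) = ≤-trans (+-mono-≤ (ℕ.>-nonZero⁻¹ _ {{m^n≢0 2 n}}) (n<2^n n))
                        (≤-reflexive (cong (2 ^ n +_) (sym (+-identityʳ (2 ^ n)))))

^-*-distrib : ∀ x y n → (x * y) ^ n ≡ x ^ n * y ^ n
^-*-distrib x y zero    = refl
^-*-distrib x y (suc n) rewrite ^-*-distrib x y n = e x y (x ^ n) (y ^ n)
  where
  e : ∀ x y a b → x * y * (a * b) ≡ x * a * (y * b)
  e = solve-∀

-- Bernoulli's inequality (1 - 1/a)^g ≥ 1 - g/a, for a = suc c.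
bernoulli : ∀ c g → suc c * suc c ^ g ≤ suc c * c ^ g + g * suc c ^ g
bernoulli c zero    = ≤-reflexive (sym (+-identityʳ _))
bernoulli c (suc g) = begin
  suc c * (suc c * suc c ^ g)               ≤⟨ *-monoʳ-≤ (suc c) (bernoulli c g) ⟩
  suc c * (suc c * c ^ g + g * suc c ^ g)   ≡⟨ e₁ c (c ^ g) g (suc c ^ g) ⟩
  suc c * (c * c ^ g) + (suc c * c ^ g + g * (suc c * suc c ^ g))
    ≤⟨ +-monoʳ-≤ (suc c * (c * c ^ g))
         (+-monoˡ-≤ (g * (suc c * suc c ^ g)) (*-monoʳ-≤ (suc c) (^-monoˡ-≤ g (n≤1+n c)))) ⟩
  suc c * (c * c ^ g) + suc g * (suc c * suc c ^ g) ∎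
  where
  open ≤-Reasoning
  e₁ : ∀ c x g y → suc c * (suc c * x + g * y) ≡ suc c * (c * x) + (suc c * x + g * (suc c * y))
  e₁ = solve-∀

-- (1 + 1/c)^(c+1) ≥ 2
double-≤-pow : ∀ c → 2 * c ^ suc c ≤ suc c ^ suc c
double-≤-pow c = ≤-trans (≤-trans (≤-reflexive (e c (c ^ c))) (+-monoʳ-≤ (c * c ^ c) (*-monoˡ-≤ (c ^ c) (n≤1+n c)))) (one+ c (suc c))
  where
  e : ∀ c x → 2 * (c * x) ≡ c * x + c * x
  e = solve-∀
  -- The first two terms of the binomial expansion. The exponent `g ∸ 1` truncates only at g = 0,
  -- where the term is multiplied by 0.
  one+ : ∀ c g → c ^ g + g * c ^ (g ∸ 1) ≤ suc c ^ g
  one+ c zero          = ≤-refl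
  one+ c (suc zero)    = ≤-reflexive (e′ c)
    where
    e′ : ∀ c → c * 1 + (1 + 0) ≡ suc c * 1
    e′ = solve-∀
  one+ c (suc (suc g)) = ≤-trans (≤-trans (m≤m+n _ (suc g * c ^ g)) (≤-reflexive (e′ c g (c ^ g))))
                                 (*-monoʳ-≤ (suc c) (one+ c (suc g)))
    where
    e′ : ∀ c g x → c * (c * x) + suc (suc g) * (c * x) + suc g * x ≡ suc c * (c * x + suc g * x)
    e′ = solve-∀

-- ((N - m)/N)^a ≤ 2^(-g) whenever m/N ≥ g/a; here P = N - m and a = suc c.
power-decay : ∀ c .{{_ : NonZero c}} P N m g → P + m ≡ N → N * g ≤ suc c * m →
              P ^ suc c * 2 ^ g ≤ N ^ suc c
power-decay c P N m g P+m≡N Ng≤am = *-cancelʳ-≤ _ _ (c ^ (a * g)) {{m^n≢0 c (a * g)}} (begin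
  P ^ a * 2 ^ g * c ^ (a * g)              ≡⟨ cong (P ^ a * 2 ^ g *_) (^-*-assoc c a g) ⟨
  P ^ a * 2 ^ g * (c ^ a) ^ g              ≡⟨ *-assoc (P ^ a) _ _ ⟩
  P ^ a * (2 ^ g * (c ^ a) ^ g)            ≡⟨ cong (P ^ a *_) (^-*-distrib 2 (c ^ a) g) ⟨
  P ^ a * (2 * c ^ a) ^ g                  ≤⟨ *-monoʳ-≤ (P ^ a) (^-monoˡ-≤ g (double-≤-pow c)) ⟩
  P ^ a * (a ^ a) ^ g                      ≡⟨ cong (P ^ a *_) (swap a) ⟩
  P ^ a * (a ^ g) ^ a                      ≡⟨ ^-*-distrib P (a ^ g) a ⟨
  (P * a ^ g) ^ a                          ≤⟨ ^-monoˡ-≤ a single ⟩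
  (N * c ^ g) ^ a                          ≡⟨ ^-*-distrib N (c ^ g) a ⟩
  N ^ a * (c ^ g) ^ a                      ≡⟨ cong (N ^ a *_) (trans (^-*-assoc c g a) (cong (c ^_) (*-comm g a))) ⟩
  N ^ a * c ^ (a * g)                      ∎)
  where
  open ≤-Reasoning
  a = suc c
  swap : ∀ x → (x ^ a) ^ g ≡ (x ^ g) ^ a
  swap x = trans (^-*-assoc x a g) (trans (cong (x ^_) (*-comm a g)) (sym (^-*-assoc x g a)))
  e₁ : ∀ a P b g → a * (P * b) + (P * g + a * 0) * b ≡ (a * P + P * g) * b
  e₁ = solve-∀
  -- By `bernoulli`, P / N ≤ 1 - g / a ≤ (c / a)^g. Above, `double-≤-pow` bounds (c / a)^a by 1/2.
  single : P * a ^ g ≤ N * c ^ g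
  single = *-cancelˡ-≤ a (+-cancelʳ-≤ (N * g * a ^ g) _ _ (begin
    a * (P * a ^ g) + N * g * a ^ g          ≤⟨ +-monoʳ-≤ (a * (P * a ^ g)) (*-monoˡ-≤ (a ^ g) Ng≤am) ⟩
    a * (P * a ^ g) + a * m * a ^ g          ≡⟨ e₂ a P (a ^ g) m ⟩
    (P + m) * (a * a ^ g)                    ≡⟨ cong (_* (a * a ^ g)) P+m≡N ⟩
    N * (a * a ^ g)                          ≤⟨ *-monoʳ-≤ N (bernoulli c g) ⟩
    N * (a * c ^ g + g * a ^ g)              ≡⟨ e₃ N a (c ^ g) g (a ^ g) ⟩
    a * (N * c ^ g) + N * g * a ^ g          ∎))
    where
    e₂ : ∀ a P b m → a * (P * b) + a * m * b ≡ (P + m) * (a * b)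
    e₂ = solve-∀
    e₃ : ∀ N a x g b → N * (a * x + g * b) ≡ a * (N * x) + N * g * b
    e₃ = solve-∀

-- (1 + 1/(2d))^d ≤ 2
compound-≤-double : ∀ d → suc (d + d) ^ d ≤ 2 * (d + d) ^ d
compound-≤-double zero        = s≤s z≤n
compound-≤-double d@(suc _) = *-cancelʳ-≤ _ _ d (begin
  suc y ^ d * d       ≤⟨ go d d refl ⟩
  y ^ d * y           ≡⟨ e (y ^ d) d ⟩
  2 * y ^ d * d       ∎)
  where
  open ≤-Reasoning
  y = d + d
  e : ∀ x d → x * (d + d) ≡ 2 * x * d
  e = solve-∀
  -- In quotients, (1 + 1/y)^i ≤ y / (y - i) with w = y - i. At i = d the right side is 2.
  go : ∀ i w → y ≡ i + w → suc y ^ i * w ≤ y ^ i * y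
  go zero    w eq = *-monoʳ-≤ 1 (≤-reflexive (sym eq))
  go (suc i) w eq = begin
    suc y * suc y ^ i * w        ≡⟨ e₁ y (suc y ^ i) w ⟩
    suc y ^ i * (y * w + w)      ≤⟨ *-monoʳ-≤ (suc y ^ i) (+-monoʳ-≤ (y * w) (≤-trans (m≤n+m w (suc i)) (≤-reflexive (sym eq)))) ⟩
    suc y ^ i * (y * w + y)      ≡⟨ e₂ (suc y ^ i) y w ⟩
    y * (suc y ^ i * suc w)      ≤⟨ *-monoʳ-≤ y (go i (suc w) (trans eq (sym (+-suc i w)))) ⟩
    y * (y ^ i * y)              ≡⟨ *-assoc y (y ^ i) y ⟨
    y * y ^ i * y                ∎
    where
    e₁ : ∀ y x w → suc y * x * w ≡ x * (y * w + w)
    e₁ = solve-∀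
    e₂ : ∀ x y w → x * (y * w + y) ≡ y * (x * suc w)
    e₂ = solve-∀

-- The number of s-subsets of an n-set that contain t given elements and avoid
-- m others, where n = f + t + m and s = t + u.
avoid-count-≤ : ∀ c .{{_ : NonZero c}} k L f t m .{{_ : NonZero m}} u →
  (f + t + m) * suc t ≤ suc c * m → suc c * L ≤ u → t + u ≤ f + t + m →
  2 * k * (t + u) ≤ 2 ^ L →
  (f C u) * 2 ^ L * (2 * k * (f + t + m)) ^ t ≤ (f + t + m) C (t + u)
avoid-count-≤ c k L f t m u dense long s≤n fine = *-cancelˡ-≤ (2 ^ (L * t)) {{m^n≢0 2 (L * t)}} (begin
  2 ^ (L * t) * ((f C u) * 2 ^ L * (2 * k * V) ^ t)
    ≡⟨ cong (λ x → 2 ^ (L * t) * ((f C u) * 2 ^ L * x)) (^-*-distrib (2 * k) V t) ⟩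
  2 ^ (L * t) * ((f C u) * 2 ^ L * ((2 * k) ^ t * V ^ t))
    ≡⟨ e₁ (2 ^ (L * t)) (f C u) (2 ^ L) ((2 * k) ^ t) (V ^ t) ⟩
  (2 * k) ^ t * ((f C u) * (2 ^ L * 2 ^ (L * t)) * V ^ t)
    ≡⟨ cong (λ x → (2 * k) ^ t * ((f C u) * x * V ^ t)) pow ⟩
  (2 * k) ^ t * ((f C u) * 2 ^ (suc t * L) * V ^ t)
    ≤⟨ *-monoʳ-≤ ((2 * k) ^ t) (*-monoˡ-≤ (V ^ t) avoid) ⟩
  (2 * k) ^ t * ((N C u) * V ^ t)
    ≤⟨ *-monoʳ-≤ ((2 * k) ^ t) contain ⟩
  (2 * k) ^ t * ((t + u) ^ t * (V C (t + u)))
    ≡⟨ *-assoc ((2 * k) ^ t) _ _ ⟨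
  (2 * k) ^ t * (t + u) ^ t * (V C (t + u))
    ≡⟨ cong (_* (V C (t + u))) (^-*-distrib (2 * k) (t + u) t) ⟨
  (2 * k * (t + u)) ^ t * (V C (t + u))
    ≤⟨ *-monoˡ-≤ (V C (t + u)) (^-monoˡ-≤ t fine) ⟩
  (2 ^ L) ^ t * (V C (t + u))
    ≡⟨ cong (_* (V C (t + u))) (^-*-assoc 2 L t) ⟩
  2 ^ (L * t) * (V C (t + u)) ∎)
  where
  open ≤-Reasoning
  V = f + t + m
  N = f + m
  a = suc c
  t+N≡V : t + N ≡ V
  t+N≡V = e f t m
    where
    e : ∀ f t m → t + (f + m) ≡ f + t + m
    e = solve-∀
  e₁ : ∀ a b c d e → a * (b * c * (d * e)) ≡ d * (b * (c * a) * e)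
  e₁ = solve-∀
  -- Avoiding the m elements gains 2^((t + 1) L). Of this, 2^(L t) pays for (2 k s)^t, which is what
  -- remains of (2 k n)^t once the t given elements are contained; 2^L is the factor claimed.
  pow : 2 ^ L * 2 ^ (L * t) ≡ 2 ^ (suc t * L)
  pow = trans (sym (^-distribˡ-+-* 2 L (L * t))) (cong (λ x → 2 ^ (L + x)) (*-comm L t))
  u≤N : u ≤ N
  u≤N = +-cancelˡ-≤ t _ _ (≤-trans s≤n (≤-reflexive (sym t+N≡V)))
  contain : (N C u) * V ^ t ≤ (t + u) ^ t * (V C (t + u))
  contain = subst (λ x → (N C u) * x ^ t ≤ (t + u) ^ t * (x C (t + u))) t+N≡V (C-subset-ratio N u t u≤N)
  decay : f ^ a * 2 ^ suc t ≤ N ^ a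
  decay = power-decay c f N m (suc t) refl
            (≤-trans (*-monoˡ-≤ (suc t) (≤-trans (m≤n+m N t) (≤-reflexive t+N≡V))) dense)
  decay-long : f ^ u * 2 ^ (suc t * L) ≤ N ^ u
  decay-long = begin
    f ^ u * 2 ^ (suc t * L)
      ≡⟨ cong (λ x → f ^ x * 2 ^ (suc t * L)) (m+[n∸m]≡n long) ⟨
    f ^ (a * L + (u ∸ a * L)) * 2 ^ (suc t * L)
      ≡⟨ cong₂ _*_ (^-distribˡ-+-* f (a * L) (u ∸ a * L)) (sym (^-*-assoc 2 (suc t) L)) ⟩
    f ^ (a * L) * f ^ (u ∸ a * L) * (2 ^ suc t) ^ L
      ≡⟨ cong (λ x → x * f ^ (u ∸ a * L) * (2 ^ suc t) ^ L) (^-*-assoc f a L) ⟨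
    (f ^ a) ^ L * f ^ (u ∸ a * L) * (2 ^ suc t) ^ L
      ≡⟨ e₂ ((f ^ a) ^ L) (f ^ (u ∸ a * L)) ((2 ^ suc t) ^ L) ⟩
    (f ^ a) ^ L * (2 ^ suc t) ^ L * f ^ (u ∸ a * L)
      ≡⟨ cong (_* f ^ (u ∸ a * L)) (^-*-distrib (f ^ a) (2 ^ suc t) L) ⟨
    (f ^ a * 2 ^ suc t) ^ L * f ^ (u ∸ a * L)
      ≤⟨ *-mono-≤ (^-monoˡ-≤ L decay) (^-monoˡ-≤ (u ∸ a * L) (m≤m+n f m)) ⟩
    (N ^ a) ^ L * N ^ (u ∸ a * L)
      ≡⟨ cong (_* N ^ (u ∸ a * L)) (^-*-assoc N a L) ⟩
    N ^ (a * L) * N ^ (u ∸ a * L)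
      ≡⟨ ^-distribˡ-+-* N (a * L) (u ∸ a * L) ⟨
    N ^ (a * L + (u ∸ a * L))
      ≡⟨ cong (N ^_) (m+[n∸m]≡n long) ⟩
    N ^ u ∎
    where
    e₂ : ∀ a b c → a * b * c ≡ a * c * b
    e₂ = solve-∀
  avoid : (f C u) * 2 ^ (suc t * L) ≤ N C u
  avoid = *-cancelʳ-≤ _ _ (N ^ u) {{m^n≢0 N u {{ℕ.>-nonZero (<-≤-trans (ℕ.>-nonZero⁻¹ m) (m≤n+m m f))}}}} (begin
    (f C u) * 2 ^ (suc t * L) * N ^ u       ≡⟨ e₃ (f C u) (2 ^ (suc t * L)) (N ^ u) ⟩
    (f C u) * N ^ u * 2 ^ (suc t * L)       ≤⟨ *-monoˡ-≤ (2 ^ (suc t * L)) (C-avoid-ratio f N u (m≤m+n f m)) ⟩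
    f ^ u * (N C u) * 2 ^ (suc t * L)       ≡⟨ e₃ (f ^ u) (N C u) (2 ^ (suc t * L)) ⟩
    f ^ u * 2 ^ (suc t * L) * (N C u)       ≤⟨ *-monoˡ-≤ (N C u) decay-long ⟩
    N ^ u * (N C u)                         ≡⟨ *-comm (N ^ u) _ ⟩
    (N C u) * N ^ u                         ∎)
    where
    e₃ : ∀ a b c → a * b * c ≡ a * c * b
    e₃ = solve-∀

-- Colorings of induced subhypergraphs

T-lookup : (S : Subset n) → ∀ {v} → v ∈ S → T (lookup S v)
T-lookup S v∈S = subst T (sym ([]=⇒lookup v∈S)) tt

∈-lookup : (S : Subset n) → ∀ {v} → T (lookup S v) → v ∈ S
∈-lookup S {v} Sv with lookup S v in eq
... | true = lookup⇒[]= v S eq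

monochromatic? : (c : Fin n → Fin l) (e : Subset n) → Dec (Monochromatic c e)
monochromatic? c e =
  Fin.all? λ u → Fin.all? λ v → (u ∈? e) →-dec ((v ∈? e) →-dec (c u Fin.≟ c v))

monochromatic-cong : {c c′ : Fin n → Fin l} → (∀ v → c v ≡ c′ v) → ∀ {e} →
                     Monochromatic c e → Monochromatic c′ e
monochromatic-cong c≗c′ mono u v u∈e v∈e = trans (sym (c≗c′ u)) (trans (mono u v u∈e v∈e) (c≗c′ v))

anyVec? : {P : Vec (Fin l) n → Set} → (∀ c → Dec (P c)) → Dec (∃ P)
anyVec? {n = zero}  P? = map′ ([] ,_) (λ { ([] , p) → p }) (P? [])
anyVec? {n = suc n} P? =
  map′ (λ (x , c , p) → x ∷ c , p) (λ { (x ∷ c , p) → x , c , p })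
       (Fin.any? λ x → anyVec? λ c → P? (x ∷ c))

-- Exhaustive search over colorings stored as vectors. A coloring given as a function agrees with
-- its tabulation only pointwise, whence `monochromatic-cong`.
colorable? : ∀ l (H : Hypergraph r n) → Dec (Colorable l H)
colorable? l H = map′
  (λ (c , proper) → lookup c , proper)
  (λ (c , proper) → tabulate c , λ e He → proper e He ∘ monochromatic-cong (lookup∘tabulate c))
  (anyVec? λ c → map′
    (λ none e He mono → none (e , He , mono))
    (λ proper (e , He , mono) → proper e He mono)
    (¬? (anySubset? λ e → T? (edge? H e) ×-dec monochromatic? (lookup c) e)))

embed : (S : Subset n) → Fin ∣ S ∣ → Fin n
embed (outside ∷ S) u       = suc (embed S u)
embed (inside  ∷ S) zero    = zero
embed (inside  ∷ S) (suc u) = suc (embed S u)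

extend : (S : Subset n) → Fin l → (Fin ∣ S ∣ → Fin l) → Fin n → Fin l
extend (outside ∷ S) d c zero    = d
extend (outside ∷ S) d c (suc v) = extend S d c v
extend (inside  ∷ S) d c zero    = c zero
extend (inside  ∷ S) d c (suc v) = extend S d (c ∘ suc) v

extend-embed : (S : Subset n) (d : Fin l) (c : Fin ∣ S ∣ → Fin l) → ∀ u → extend S d c (embed S u) ≡ c u
extend-embed (outside ∷ S) d c u       = extend-embed S d c u
extend-embed (inside  ∷ S) d c zero    = refl
extend-embed (inside  ∷ S) d c (suc u) = extend-embed S d (c ∘ suc) u

restrict : (S : Subset n) → Subset n → Subset ∣ S ∣
restrict []            []      = []
restrict (outside ∷ S) (b ∷ e) = restrict S e
restrict (inside  ∷ S) (b ∷ e) = b ∷ restrict S e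

expand-restrict : (S e : Subset n) → (∀ v → T (lookup e v) → T (lookup S v)) →
                  expand S (restrict S e) ≡ e
expand-restrict []            []            e⊆S = refl
expand-restrict (outside ∷ S) (outside ∷ e) e⊆S = cong (outside ∷_) (expand-restrict S e (e⊆S ∘ suc))
expand-restrict (outside ∷ S) (inside  ∷ e) e⊆S = ⊥-elim (e⊆S zero tt)
expand-restrict (inside  ∷ S) (b       ∷ e) e⊆S = cong (b ∷_) (expand-restrict S e (e⊆S ∘ suc))

lookup-expand : (S : Subset n) (U : Subset ∣ S ∣) → ∀ u → lookup (expand S U) (embed S u) ≡ lookup U u
lookup-expand (outside ∷ S) U       u       = lookup-expand S U u
lookup-expand (inside  ∷ S) (b ∷ U) zero    = refl
lookup-expand (inside  ∷ S) (b ∷ U) (suc u) = lookup-expand S U u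

embed-onto : (S : Subset n) (U : Subset ∣ S ∣) → ∀ v → T (lookup (expand S U) v) →
             ∃ λ u → embed S u ≡ v
embed-onto (outside ∷ S) U       (suc v) x = let u , eq = embed-onto S U v x in u , cong suc eq
embed-onto (inside  ∷ S) (b ∷ U) zero    x = zero , refl
embed-onto (inside  ∷ S) (b ∷ U) (suc v) x = let u , eq = embed-onto S U v x in suc u , cong suc eq

∈-expand : (S : Subset n) (U : Subset ∣ S ∣) → ∀ {u} → u ∈ U → embed S u ∈ expand S U
∈-expand S U {u} u∈U = ∈-lookup (expand S U) (subst T (sym (lookup-expand S U u)) (T-lookup U u∈U))

induced-colorable : (H : Hypergraph r n) (S : Subset n) → Colorable l H → Colorable l (induced H S)
induced-colorable H S (c , proper) = c ∘ embed S , λ U HU mono → proper (expand S U) HU (mono-expand U mono)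
  where
  mono-expand : ∀ U → Monochromatic (c ∘ embed S) U → Monochromatic c (expand S U)
  mono-expand U mono v w v∈ w∈
    with embed-onto S U v (T-lookup _ v∈) | embed-onto S U w (T-lookup _ w∈)
  ... | u , refl | x , refl =
    mono u x (∈-lookup U (subst T (lookup-expand S U u) (T-lookup _ v∈)))
             (∈-lookup U (subst T (lookup-expand S U x) (T-lookup _ w∈)))

-- Properness on H[S] for a coloring of all of `Fin n`, so that the colorings of different samples
-- can be queried at the same vertex. Colors outside `S` are arbitrary.
ProperOn : Hypergraph r n → Subset n → (Fin n → Fin l) → Set
ProperOn H S c = ∀ e → T (edge? H e) → (∀ v → T (lookup e v) → T (lookup S v)) → ¬ Monochromatic c e

extend-proper : (H : Hypergraph r n) (S : Subset n) → Fin l → Colorable l (induced H S) →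
                ∃ λ (c : Fin n → Fin l) → ProperOn H S c
extend-proper H S d (c , proper) = extend S d c , λ e He e⊆S mono →
  proper (restrict S e) (subst (T ∘ edge? H) (sym (expand-restrict S e e⊆S)) He) λ u v u∈ v∈ → begin
    c u                        ≡⟨ extend-embed S d c u ⟨
    extend S d c (embed S u)   ≡⟨ mono _ _ (∈e e⊆S u∈) (∈e e⊆S v∈) ⟩
    extend S d c (embed S v)   ≡⟨ extend-embed S d c v ⟩
    c v                        ∎
  where
  open ≡-Reasoning
  ∈e : ∀ {e} (e⊆S : ∀ v → T (lookup e v) → T (lookup S v)) {u} → u ∈ restrict S e → embed S u ∈ e
  ∈e {e} e⊆S u∈ = subst (embed S _ ∈_) (expand-restrict S e e⊆S) (∈-expand S (restrict S e) u∈)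

-- Turns a coloring into a colorable hypergraph that differs from H only in edges monochromatic
-- under `c`; being far then yields many such edges for every `c`.
removeMonochromatic : Hypergraph r n → (Fin n → Fin l) → Hypergraph r n
removeMonochromatic H c = record
  { edge?   = λ e → edge? H e ∧ not (does (monochromatic? c e))
  ; uniform = λ e → uniform H e ∘ proj₁ ∘ ∧-elim
  }

removeMonochromatic-colorable : (H : Hypergraph r n) (c : Fin n → Fin l) →
                                Colorable l (removeMonochromatic H c)
removeMonochromatic-colorable H c = c , λ e He mono →
  not-elim (proj₂ (∧-elim {edge? H e} He)) (does-intro (monochromatic? c e) mono)

removed-edge : (H : Hypergraph r n) (c : Fin n → Fin l) → ∀ e →
  T (edge? H e xor edge? (removeMonochromatic H c) e) → T (edge? H e) × Monochromatic c e
removed-edge H c e t = let He , mono = split (edge? H e) _ t in He , does-elim (monochromatic? c e) mono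
  where
  split : ∀ a b → T (a xor (a ∧ not b)) → T a × T b
  split true true _ = tt , tt

-- The decision process

C-positive : ∀ r h → 0 < (r + h) C r
C-positive r h = ℕ.>-nonZero⁻¹ _ {{C-nonZero (m≤m+n r h)}}

-- `fixed c` says that the vertex is in the sample with color `c`. `undecided X` says only that its
-- color lies in `X` if it is in the sample; with `X` empty, the sample avoids the vertex.
data Status (k : ℕ) : Set where
  fixed     : Fin k → Status k
  undecided : (Fin k → Bool) → Status k

module _ {k : ℕ} where

  alive : Status k → Fin k → Bool
  alive (fixed c)     x = does (x Fin.≟ c)
  alive (undecided X) x = X x

  isFixed : Status k → Bool
  isFixed (fixed _)     = true
  isFixed (undecided _) = false

  -- The number of queries that can still be asked about the vertex.
  weight : Status k → ℕ
  weight (fixed _)     = 0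
  weight (undecided X) = ∑ (ind ∘ X)

  Compatible : Status k → Bool → Fin k → Set
  Compatible (fixed c)     b x = T b × x ≡ c
  Compatible (undecided X) b x = T b → T (X x)

  _without_ : (Fin k → Bool) → Fin k → Fin k → Bool
  (X without c) x = X x ∧ not (does (x Fin.≟ c))

  without-< : ∀ X c → T (X c) → ∑ (ind ∘ (X without c)) < ∑ (ind ∘ X)
  without-< X c Xc = ∑-mono-< (λ x → ind-mono (proj₁ ∘ ∧-elim)) c
    (subst₂ _<_ (sym removed) (sym (ind-true Xc)) ≤-refl)
    where
    removed : ind ((X without c) c) ≡ 0
    removed with X c | c Fin.≟ c
    ... | true  | yes _  = refl
    ... | true  | no c≢c = ⊥-elim (c≢c refl)
    ... | false | _      = refl

  weight-positive : ∀ x c → isFixed x ≡ false → T (alive x c) → 0 < weight x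
  weight-positive (undecided X) c _ Xc = ≤-trans (≤-reflexive (sym (ind-true Xc))) (≤-∑ (ind ∘ X) c)

module _ {n : ℕ} {X : Set} where

  set : (Fin n → X) → Fin n → X → Fin n → X
  set f v x u = if does (u Fin.≟ v) then x else f u

  set-same : ∀ f v x → set f v x v ≡ x
  set-same f v x with v Fin.≟ v
  ... | yes _  = refl
  ... | no v≢v = ⊥-elim (v≢v refl)

  set-other : ∀ f v x u → u ≢ v → set f v x u ≡ f u
  set-other f v x u u≢v with u Fin.≟ v
  ... | yes u≡v = ⊥-elim (u≢v u≡v)
  ... | no _    = refl

  set-elim : ∀ f v x (P : Fin n → X → Set) → P v x → (∀ u → u ≢ v → P u (f u)) → ∀ u → P u (set f v x u)
  set-elim f v x P Pv Pu u with u Fin.≟ v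
  ... | yes refl = Pv
  ... | no u≢v   = Pu u u≢v

module Process
  {q′ n k : ℕ} (H : Hypergraph (suc q′) n) (h : ℕ) (n≡ : n ≡ suc q′ + h)
  (χ : Subset n → Fin n → Fin k) (s y N : ℕ)
  where

  q D : ℕ
  q = suc q′
  D = (q′ + h) C q′

  -- With denominators cleared: the proportion of `p` is at most y^(-t) (1 + 1/y)^d / 4, where t
  -- counts the positive answers so far and d bounds the queries still to come.
  Bound : (Subset n → Bool) → ℕ → ℕ → Set
  Bound p t d = #subsets p * (4 * y ^ t * y ^ d) ≤ N * suc y ^ d

  State : Set
  State = Fin n → Status k

  Colors : Set
  Colors = Fin n → Fin k → Bool

  palette : State → Colors
  palette st v = alive (st v)

  -- `p` is the set of samples consistent with the answers so far, and `Γ` the palette when the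
  -- current scale began. `fuel` is an inequality because a positive answer uses up all remaining
  -- colors of its vertex at once.
  record Invariant (Γ : Colors) (p : Subset n → Bool) (t d : ℕ) (st : State) : Set where
    field
      proper : ∀ S → T (p S) → ProperOn H S (χ S)
      size   : ∀ S → T (p S) → ∣ S ∣ ≡ s
      compat : ∀ S → T (p S) → ∀ v → Compatible (st v) (lookup S v) (χ S v)
      count  : ∑ (ind ∘ isFixed ∘ st) ≡ t
      fuel   : ∑ (weight ∘ st) ≤ d
      below  : ∀ v c → T (palette st v c) → T (Γ v c)

  open Invariant

  bound-empty : ∀ p {t d} → (∀ S → ¬ T (p S)) → Bound p t d
  bound-empty p none rewrite #subsets-none p none = z≤n

  -- The positive branch carries an extra factor 1/y and the negative branch a factor 1; they add up
  -- to 1 + 1/y, the allowance that `Bound` makes for one query.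
  query : ∀ {Γ p t d st} → Invariant Γ p t (suc d) st →
    ∀ v X c → st v ≡ undecided X → T (X c) →
    (∀ p′ → Invariant Γ p′ (suc t) d (set st v (fixed c)) → Bound p′ (suc t) d) →
    (∀ p′ → Invariant Γ p′ t d (set st v (undecided (X without c))) → Bound p′ t d) →
    Bound p t (suc d)
  query {Γ} {p} {t} {d} {st} inv v X c stv Xc yes-case no-case = begin
    #subsets p * (4 * y ^ t * (y * y ^ d))
      ≤⟨ *-monoˡ-≤ _ (cnt-⊎ split (subsets n)) ⟩
    (#subsets p₁ + #subsets p₀) * (4 * y ^ t * (y * y ^ d))
      ≡⟨ e₁ (#subsets p₁) (#subsets p₀) y (y ^ t) (y ^ d) ⟩
    #subsets p₁ * (4 * (y * y ^ t) * y ^ d) + y * (#subsets p₀ * (4 * y ^ t * y ^ d))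
      ≤⟨ +-mono-≤ (yes-case p₁ inv₁) (*-monoʳ-≤ y (no-case p₀ inv₀)) ⟩
    N * suc y ^ d + y * (N * suc y ^ d)
      ≡⟨ e₂ N y (suc y ^ d) ⟩
    N * (suc y * suc y ^ d) ∎
    where
    open ≤-Reasoning
    answer : Subset n → Bool
    answer S = lookup S v ∧ does (χ S v Fin.≟ c)
    p₁ p₀ : Subset n → Bool
    p₁ S = p S ∧ answer S
    p₀ S = p S ∧ not (answer S)
    split : ∀ S → T (p S) → T (p₁ S) ⊎ T (p₀ S)
    split S pS with answer S in eq
    ... | true  = inj₁ (∧-intro pS tt)
    ... | false = inj₂ (∧-intro pS tt)
    e₁ : ∀ a b y x z → (a + b) * (4 * x * (y * z)) ≡ a * (4 * (y * x) * z) + y * (b * (4 * x * z))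
    e₁ = solve-∀
    e₂ : ∀ N y x → N * x + y * (N * x) ≡ N * (suc y * x)
    e₂ = solve-∀
    lighter : ∀ x → weight x < weight (st v) → ∑ (weight ∘ set st v x) ≤ d
    lighter x lt = ≤-pred (≤-trans
      (∑-mono-< (set-elim st v x (λ u x → weight x ≤ weight (st u)) (<⇒≤ lt) (λ _ _ → ≤-refl))
                v (subst (_< weight (st v)) (sym (cong weight (set-same st v x))) lt))
      (fuel inv))
    inv₁ : Invariant Γ p₁ (suc t) d (set st v (fixed c))
    proper inv₁ S = proper inv S ∘ proj₁ ∘ ∧-elim
    size   inv₁ S = size inv S ∘ proj₁ ∘ ∧-elim
    compat inv₁ S p₁S = set-elim st v (fixed c) (λ u x → Compatible x (lookup S u) (χ S u))
      (let Sv , χv = ∧-elim (proj₂ (∧-elim {p S} p₁S)) in Sv , does-elim (χ S v Fin.≟ c) χv)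
      (λ u _ → compat inv S (proj₁ (∧-elim p₁S)) u)
    count  inv₁ = trans
      (∑-suc-at v (trans (cong (ind ∘ isFixed) (set-same st v _)) (sym (cong (suc ∘ ind ∘ isFixed) stv)))
                  (λ u u≢v → cong (ind ∘ isFixed) (set-other st v _ u u≢v)))
      (cong suc (count inv))
    fuel   inv₁ = lighter (fixed c)
      (subst (0 <_) (sym (cong weight stv)) (weight-positive (undecided X) c refl Xc))
    below  inv₁ = set-elim st v (fixed c) (λ u x → ∀ c′ → T (alive x c′) → T (Γ u c′))
      (λ c′ c′≡c → below inv v c′ (subst (λ x → T (alive x c′)) (sym stv)
                                          (subst (T ∘ X) (sym (does-elim (c′ Fin.≟ c) c′≡c)) Xc)))
      (λ u _ → below inv u)
    inv₀ : Invariant Γ p₀ t d (set st v (undecided (X without c)))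
    proper inv₀ S = proper inv S ∘ proj₁ ∘ ∧-elim
    size   inv₀ S = size inv S ∘ proj₁ ∘ ∧-elim
    compat inv₀ S p₀S = set-elim st v (undecided (X without c)) (λ u x → Compatible x (lookup S u) (χ S u))
      (λ Sv → ∧-intro (subst (λ x → Compatible x (lookup S v) (χ S v)) stv (compat inv S (proj₁ (∧-elim p₀S)) v) Sv)
                      (not-intro λ χv → not-elim (proj₂ (∧-elim {p S} p₀S)) (∧-intro Sv χv)))
      (λ u _ → compat inv S (proj₁ (∧-elim p₀S)) u)
    count  inv₀ = trans
      (∑-cong (set-elim st v (undecided (X without c)) (λ u x → ind (isFixed x) ≡ ind (isFixed (st u)))
                (sym (cong (ind ∘ isFixed) stv)) (λ _ _ → refl)))
      (count inv)
    fuel   inv₀ = lighter (undecided (X without c))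
      (subst (∑ (ind ∘ (X without c)) <_) (sym (cong weight stv)) (without-< X c Xc))
    below  inv₀ = set-elim st v (undecided (X without c)) (λ u x → ∀ c′ → T (alive x c′) → T (Γ u c′))
      (λ c′ Xc′ → below inv v c′ (subst (λ x → T (alive x c′)) (sym stv) (proj₁ (∧-elim Xc′))))
      (λ u _ → below inv u)

  -- Degrees among the possible vertices of one color

  incident : Colors → Fin n → Fin k → Subset n → Bool
  incident Γ v c e =
    edge? H e ∧ (lookup e v ∧ does (Fin.all? λ u → T? (lookup e u) →-dec T? (Γ u c)))

  degree : Colors → Fin n → Fin k → ℕ
  degree Γ v c = #subsets (incident Γ v c)

  incident-edge : ∀ Γ v c e → T (incident Γ v c e) → T (edge? H e)
  incident-edge Γ v c e = proj₁ ∘ ∧-elim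

  incident-∋ : ∀ Γ v c e → T (incident Γ v c e) → T (lookup e v)
  incident-∋ Γ v c e = proj₁ ∘ ∧-elim ∘ proj₂ ∘ ∧-elim {edge? H e}

  incident-⊆ : ∀ Γ v c e → T (incident Γ v c e) → ∀ u → T (lookup e u) → T (Γ u c)
  incident-⊆ Γ v c e t = does-elim (Fin.all? λ u → T? (lookup e u) →-dec T? (Γ u c))
    (proj₂ (∧-elim {lookup e v} (proj₂ (∧-elim {edge? H e} t))))

  incident-intro : ∀ Γ v c e → T (edge? H e) → T (lookup e v) → (∀ u → T (lookup e u) → T (Γ u c)) →
                   T (incident Γ v c e)
  incident-intro Γ v c e He ev e⊆ = ∧-intro He (∧-intro ev
    (does-intro (Fin.all? λ u → T? (lookup e u) →-dec T? (Γ u c)) e⊆))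

  edge-size : ∀ e → T (edge? H e) → ∑ (ind ∘ lookup e) ≡ q
  edge-size e He = trans (sym ∣ e ∣≡∑) (uniform H e He)

  -- The extensions of a (q - r)-set to a q-set.
  P : ℕ → ℕ
  P r = (r + h) C r

  P-suc : ∀ r → suc r * P (suc r) ≡ (suc r + h) * P r
  P-suc r = C-absorb (r + h) r

  superset-count-≤ : ∀ A r (Q : Subset n → Bool) → ∑ (ind ∘ A) + r ≡ q →
    (∀ e → T (Q e) → T (edge? H e)) → (∀ e → T (Q e) → ∀ v → T (A v) → T (lookup e v)) →
    #subsets Q ≤ P r
  superset-count-≤ A r Q A-size Q-edge Q⊇A =
    subst (λ f → #subsets Q ≤ f C r) free≡
      (#subsets-between A (λ _ → false) r Q
        (λ e Qe → trans (uniform H e (Q-edge e Qe)) (sym A-size)) Q⊇A (λ _ _ _ ()))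
    where
    open ≡-Reasoning
    ∧-true : ∀ b → ind (b ∧ true) ≡ ind b
    ∧-true true  = refl
    ∧-true false = refl
    e₁ : ∀ a r h → (a + r) + h ≡ (r + h) + a
    e₁ = solve-∀
    free≡ : free A (λ _ → false) ≡ r + h
    free≡ = +-cancelʳ-≡ (∑ (ind ∘ A)) _ _ (begin
      free A (λ _ → false) + ∑ (ind ∘ A)   ≡⟨ cong (_+ ∑ (ind ∘ A)) (∑-cong λ v → ∧-true (not (A v))) ⟩
      ∑ (ind ∘ not ∘ A) + ∑ (ind ∘ A)      ≡⟨ ∑-complement A ⟩
      n                                    ≡⟨ n≡ ⟩
      q + h                                ≡⟨ cong (_+ h) A-size ⟨
      ∑ (ind ∘ A) + r + h                  ≡⟨ e₁ (∑ (ind ∘ A)) r h ⟩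
      r + h + ∑ (ind ∘ A)                  ∎)

  singleton : Fin n → Fin n → Bool
  singleton v u = does (u Fin.≟ v)

  singleton-size : ∀ v → ∑ (ind ∘ singleton v) ≡ 1
  singleton-size v = trans
    (∑-suc-at {f = λ _ → 0} v (cong ind (dec-true (v Fin.≟ v) refl))
              (λ u u≢v → cong ind (dec-false (u Fin.≟ v) u≢v)))
    (cong suc (trans (∑-const n 0) (*-zeroʳ n)))

  degree-≤ : ∀ Γ v c → degree Γ v c ≤ D
  degree-≤ Γ v c = superset-count-≤ (singleton v) q′ (incident Γ v c)
    (cong (_+ q′) (singleton-size v)) (incident-edge Γ v c)
    (λ e t u u≡v → subst (T ∘ lookup e) (sym (does-elim (u Fin.≟ v) u≡v)) (incident-∋ Γ v c e t))

  -- A round: following one dense family of edges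

  module Round (z : ℕ) (Γ : Colors) where

    -- A is the part already known to have colour c of the edges of the family
    -- Q.  The proportion of Q among all q-sets containing A stays at least
    -- 1 / z - κ q / n, where κ counts the queries made in the round.
    record Family (st : State) (A : Fin n → Bool) (Q : Subset n → Bool) (c : Fin k) (r κ : ℕ) : Set where
      field
        A-size  : ∑ (ind ∘ A) + r ≡ q
        A-fixed : ∀ v → T (A v) → st v ≡ fixed c
        Q-edge  : ∀ e → T (Q e) → T (edge? H e)
        Q⊇A     : ∀ e → T (Q e) → ∀ v → T (A v) → T (lookup e v)
        Q-alive : ∀ e → T (Q e) → ∀ v → T (lookup e v) → T (palette st v c)
        dense   : n * P r ≤ n * z * #subsets Q + κ * (q * z) * P r

    open Family

    -- The density holds for every κ, so the query that fixes `v`, if one is needed, can be charged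
    -- to the round: `scan-step` takes κ = 0 or κ = 1.
    start : ∀ {st st′ v c κ} → D ≤ degree (palette st) v c * z → st′ v ≡ fixed c →
            (∀ u → u ≢ v → st′ u ≡ st u) →
            Family st′ (singleton v) (incident (palette st) v c) c q′ κ
    A-size  (start {v = v} _ _ _) = cong (_+ q′) (singleton-size v)
    A-fixed (start {st′ = st′} {v} {c} _ stv _) u u≡v = subst (λ u → st′ u ≡ fixed c) (sym (does-elim (u Fin.≟ v) u≡v)) stv
    Q-edge  (start {st} {v = v} {c} _ _ _) = incident-edge (palette st) v c
    Q⊇A     (start {st} {v = v} {c} _ _ _) e t u u≡v = subst (T ∘ lookup e) (sym (does-elim (u Fin.≟ v) u≡v)) (incident-∋ (palette st) v c e t)
    Q-alive (start {st} {st′} {v} {c} _ stv stu) e t u eu with u Fin.≟ v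
    ... | yes refl = subst (λ x → T (alive x c)) (sym stv) (does-intro (c Fin.≟ c) refl)
    ... | no u≢v   = subst (λ x → T (alive x c)) (sym (stu u u≢v)) (incident-⊆ (palette st) v c e t u eu)
    dense   (start {st} {v = v} {c} {κ} big _ _) = begin
      n * D                                    ≤⟨ *-monoʳ-≤ n big ⟩
      n * (degree (palette st) v c * z)        ≡⟨ e₁ n (degree (palette st) v c) z ⟩
      n * z * degree (palette st) v c          ≤⟨ m≤m+n _ _ ⟩
      n * z * degree (palette st) v c + κ * (q * z) * D ∎
      where
      open ≤-Reasoning
      e₁ : ∀ n d z → n * (d * z) ≡ n * z * d
      e₁ = solve-∀

    grown-size : ∀ {st A Q c r κ} → Family st A Q c (suc r) κ → ∀ v → ¬ T (A v) →
                 ∑ (ind ∘ set A v true) + r ≡ q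
    grown-size {A = A} {r = r} fam v ¬Av = trans
      (cong (_+ r) (∑-suc-at v (trans (cong ind (set-same A v true)) (cong suc (sym (ind-false ¬Av))))
                               (λ u u≢v → cong ind (set-other A v true u u≢v))))
      (trans (sym (+-suc _ r)) (A-size fam))

    -- From r + 1 to r, `P` shrinks by the factor (r + 1) / (r + 1 + h), and a vertex of at least
    -- average popularity keeps no less than that fraction of `Q`.
    grow : ∀ {st st′ A Q c r κ κ′} → Family st A Q c (suc r) κ → ∀ v → ¬ T (A v) →
           suc r * #subsets Q ≤ (suc r + h) * #subsets (λ e → Q e ∧ lookup e v) →
           st′ v ≡ fixed c → (∀ u → u ≢ v → st′ u ≡ st u) → κ ≤ κ′ →
           Family st′ (set A v true) (λ e → Q e ∧ lookup e v) c r κ′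
    A-size  (grow fam v ¬Av avg stv stu κ≤) = grown-size fam v ¬Av
    A-fixed (grow {st} {st′} {A} {c = c} fam v ¬Av avg stv stu κ≤) =
      set-elim A v true (λ u b → T b → st′ u ≡ fixed c) (λ _ → stv)
               (λ u u≢v Au → trans (stu u u≢v) (A-fixed fam u Au))
    Q-edge  (grow fam v ¬Av avg stv stu κ≤) e t = Q-edge fam e (proj₁ (∧-elim t))
    Q⊇A     (grow {A = A} {Q} fam v ¬Av avg stv stu κ≤) e t =
      set-elim A v true (λ u b → T b → T (lookup e u)) (λ _ → proj₂ (∧-elim {Q e} t))
               (λ u _ Au → Q⊇A fam e (proj₁ (∧-elim t)) u Au)
    Q-alive (grow {c = c} fam v ¬Av avg stv stu κ≤) e t u eu with u Fin.≟ v
    ... | yes refl = subst (λ x → T (alive x c)) (sym stv) (does-intro (c Fin.≟ c) refl)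
    ... | no u≢v   = subst (λ x → T (alive x c)) (sym (stu u u≢v)) (Q-alive fam e (proj₁ (∧-elim t)) u eu)
    dense   (grow {Q = Q} {r = r} {κ} {κ′} fam v ¬Av avg stv stu κ≤) = *-cancelˡ-≤ (suc r + h) (begin
      (suc r + h) * (n * P r)                        ≡⟨ e₁ (suc r + h) n (P r) ⟩
      n * ((suc r + h) * P r)                        ≡⟨ cong (n *_) (P-suc r) ⟨
      n * (suc r * P (suc r))                        ≡⟨ e₁ n (suc r) (P (suc r)) ⟩
      suc r * (n * P (suc r))                        ≤⟨ *-monoʳ-≤ (suc r) (dense fam) ⟩
      suc r * (n * z * X + κ * (q * z) * P (suc r))  ≡⟨ e₂ (suc r) (n * z) X (κ * (q * z)) (P (suc r)) ⟩
      n * z * (suc r * X) + κ * (q * z) * (suc r * P (suc r))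
        ≤⟨ +-mono-≤ (*-monoʳ-≤ (n * z) avg) (*-mono-≤ (*-monoˡ-≤ (q * z) κ≤) (≤-reflexive (P-suc r))) ⟩
      n * z * ((suc r + h) * X′) + κ′ * (q * z) * ((suc r + h) * P r)
        ≡⟨ e₂ (suc r + h) (n * z) X′ (κ′ * (q * z)) (P r) ⟨
      (suc r + h) * (n * z * X′ + κ′ * (q * z) * P r) ∎)
      where
      open ≤-Reasoning
      X X′ : ℕ
      X  = #subsets Q
      X′ = #subsets (λ e → Q e ∧ lookup e v)
      e₁ : ∀ a b c → a * (b * c) ≡ b * (a * c)
      e₁ = solve-∀
      e₂ : ∀ a b x c y → a * (b * x + c * y) ≡ b * (a * x) + c * (a * y)
      e₂ = solve-∀

    -- The edges lost contain `A` and v, so there are at most `P r` of them, and P r / P (r + 1) =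
    -- (r + 1) / (r + 1 + h) ≤ q / (q + h) = q / n because r + 1 ≤ q. One more unit of κ pays for
    -- this.
    drop : ∀ {st st′ A Q c r κ} → Family st A Q c (suc r) κ → ∀ v → ¬ T (A v) →
           (∀ u → u ≢ v → st′ u ≡ st u) →
           Family st′ A (λ e → Q e ∧ not (lookup e v)) c (suc r) (suc κ)
    A-size  (drop fam v ¬Av stu) = A-size fam
    A-fixed (drop fam v ¬Av stu) u Au =
      trans (stu u λ { refl → ¬Av Au }) (A-fixed fam u Au)
    Q-edge  (drop fam v ¬Av stu) e t = Q-edge fam e (proj₁ (∧-elim t))
    Q⊇A     (drop fam v ¬Av stu) e t = Q⊇A fam e (proj₁ (∧-elim t))
    Q-alive (drop {Q = Q} {c} fam v ¬Av stu) e t u eu =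
      subst (λ x → T (alive x c)) (sym (stu u λ { refl → not-elim (proj₂ (∧-elim {Q e} t)) eu }))
            (Q-alive fam e (proj₁ (∧-elim t)) u eu)
    dense   (drop {A = A} {Q} {r = r} {κ} fam v ¬Av stu) = begin
      n * P (suc r)                                        ≤⟨ dense fam ⟩
      n * z * X + κ * (q * z) * P (suc r)
        ≤⟨ +-monoˡ-≤ _ (*-monoʳ-≤ (n * z) (cnt-⊎ split (subsets n))) ⟩
      n * z * (X₀ + X₁) + κ * (q * z) * P (suc r)          ≡⟨ e₁ n z X₀ X₁ (κ * (q * z) * P (suc r)) ⟩
      n * z * X₀ + z * (n * X₁) + κ * (q * z) * P (suc r)
        ≤⟨ +-monoˡ-≤ _ (+-monoʳ-≤ (n * z * X₀) (*-monoʳ-≤ z (≤-trans (*-monoʳ-≤ n X₁≤) loss))) ⟩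
      n * z * X₀ + z * (q * P (suc r)) + κ * (q * z) * P (suc r) ≡⟨ e₂ (n * z * X₀) z q (P (suc r)) κ ⟩
      n * z * X₀ + suc κ * (q * z) * P (suc r)             ∎
      where
      open ≤-Reasoning
      X X₀ X₁ : ℕ
      X  = #subsets Q
      X₀ = #subsets (λ e → Q e ∧ not (lookup e v))
      X₁ = #subsets (λ e → Q e ∧ lookup e v)
      split : ∀ e → T (Q e) → T (Q e ∧ not (lookup e v)) ⊎ T (Q e ∧ lookup e v)
      split e Qe with lookup e v
      ... | true  = inj₂ (∧-intro Qe tt)
      ... | false = inj₁ (∧-intro Qe tt)
      X₁≤ : X₁ ≤ P r
      X₁≤ = superset-count-≤ (set A v true) r _
        (grown-size fam v ¬Av)
        (λ e t → Q-edge fam e (proj₁ (∧-elim t)))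
        (λ e t → set-elim A v true (λ u b → T b → T (lookup e u)) (λ _ → proj₂ (∧-elim {Q e} t))
                          (λ u _ Au → Q⊇A fam e (proj₁ (∧-elim t)) u Au))
      r<q : suc r ≤ q
      r<q = ≤-trans (m≤n+m (suc r) _) (≤-reflexive (A-size fam))
      e₃ : ∀ n r P → r * (n * P) ≡ n * r * P
      e₃ = solve-∀
      e₄ : ∀ q h r → (q + h) * r ≡ q * r + h * r
      e₄ = solve-∀
      e₅ : ∀ q r h P → (q * r + h * q) * P ≡ q * ((r + h) * P)
      e₅ = solve-∀
      e₆ : ∀ q r P → q * (r * P) ≡ r * (q * P)
      e₆ = solve-∀
      loss : n * P r ≤ q * P (suc r)
      loss = *-cancelˡ-≤ (suc r) (begin
        suc r * (n * P r)                ≡⟨ e₃ n (suc r) (P r) ⟩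
        n * suc r * P r                  ≡⟨ cong (λ x → x * suc r * P r) n≡ ⟩
        (q + h) * suc r * P r            ≡⟨ cong (_* P r) (e₄ q h (suc r)) ⟩
        (q * suc r + h * suc r) * P r    ≤⟨ *-monoˡ-≤ (P r) (+-monoʳ-≤ (q * suc r) (*-monoʳ-≤ h r<q)) ⟩
        (q * suc r + h * q) * P r        ≡⟨ e₅ q (suc r) h (P r) ⟩
        q * ((suc r + h) * P r)          ≡⟨ cong (q *_) (P-suc r) ⟨
        q * (suc r * P (suc r))          ≡⟨ e₆ q (suc r) (P (suc r)) ⟩
        suc r * (q * P (suc r))          ∎)
      e₁ : ∀ n z a b c → n * z * (a + b) + c ≡ n * z * a + z * (n * b) + c
      e₁ = solve-∀
      e₂ : ∀ a z q P κ → a + z * (q * P) + κ * (q * z) * P ≡ a + suc κ * (q * z) * P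
      e₂ = solve-∀

    nonempty : ∀ {st A Q c r κ} → Family st A Q c r κ → ¬ n ≤ κ * (q * z) → 0 < #subsets Q
    nonempty {Q = Q} {r = r} {κ} fam small with #subsets Q in X≡
    ... | suc _ = s≤s z≤n
    ... | zero  = ⊥-elim (small (*-cancelʳ-≤ _ _ (P r) {{ℕ.>-nonZero (C-positive r h)}} (begin
      n * P r                               ≤⟨ dense fam ⟩
      n * z * #subsets Q + κ * (q * z) * P r ≡⟨ cong (λ x → n * z * x + κ * (q * z) * P r) X≡ ⟩
      n * z * 0 + κ * (q * z) * P r         ≡⟨ cong (_+ κ * (q * z) * P r) (*-zeroʳ (n * z)) ⟩
      κ * (q * z) * P r                     ∎)))
      where open ≤-Reasoning

    -- Each edge of `Q` has r + 1 of its vertices among the r + 1 + h vertices outside `A`, so some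
    -- vertex there reaches the average. As it lies on an edge of `Q`, color `c` is still possible
    -- for it and may be queried.
    popular-vertex : ∀ {st A Q c r κ} → Family st A Q c (suc r) κ → 0 < #subsets Q →
      ∃ λ v → ¬ T (A v) × T (palette st v c) ×
              suc r * #subsets Q ≤ (suc r + h) * #subsets (λ e → Q e ∧ lookup e v)
    popular-vertex {st} {A} {Q} {c} {r} fam X>0 =
      let v , ¬Av , avg = weighted-average (not ∘ A) f (r + h) (suc r * #subsets Q) rest total
          e , t = cnt-witness (λ e → Q e ∧ lookup e v) (subsets n) (positive v avg)
      in v , not-elim ¬Av , Q-alive fam e (proj₁ (∧-elim t)) v (proj₂ (∧-elim {Q e} t)) , avg
      where
      open ≤-Reasoning
      f : Fin n → ℕ
      f v = #subsets (λ e → Q e ∧ lookup e v)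
      positive : ∀ v → suc r * #subsets Q ≤ (suc r + h) * f v → 0 < f v
      positive v avg with f v
      ... | suc _ = s≤s z≤n
      ... | zero  = ⊥-elim (<-irrefl refl (<-≤-trans X>0 (≤-trans (m≤m+n _ _)
                      (≤-trans avg (≤-reflexive (*-zeroʳ (r + h)))))))
      e₁ : ∀ a r h → a + r + h ≡ r + h + a
      e₁ = solve-∀
      rest : suc (r + h) ≡ ∑ (ind ∘ not ∘ A)
      rest = +-cancelʳ-≡ (∑ (ind ∘ A)) _ _
        (trans (trans (trans (sym (e₁ (∑ (ind ∘ A)) (suc r) h)) (cong (_+ h) (A-size fam))) (sym n≡))
               (sym (∑-complement A)))
      outside-A : ∀ e → T (Q e) → suc r ≤ ∑ (λ v → ind (not (A v) ∧ lookup e v))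
      outside-A e Qe = +-cancelˡ-≤ (∑ (ind ∘ A)) _ _ (begin
        ∑ (ind ∘ A) + suc r                     ≡⟨ A-size fam ⟩
        q                                       ≡⟨ edge-size e (Q-edge fam e Qe) ⟨
        ∑ (ind ∘ lookup e)                      ≤⟨ ∑-mono (λ v → split (A v) (lookup e v)) ⟩
        ∑ (λ v → ind (A v) + ind (not (A v) ∧ lookup e v)) ≡⟨ ∑-+ (ind ∘ A) _ ⟩
        ∑ (ind ∘ A) + ∑ (λ v → ind (not (A v) ∧ lookup e v)) ∎)
        where
        split : ∀ a b → ind b ≤ ind a + ind (not a ∧ b)
        split true  b = ≤-trans (ind-mono {b} {true} _) (s≤s z≤n)
        split false b = ≤-refl
      total : suc r * #subsets Q ≤ ∑ (λ v → ind (not (A v)) * f v)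
      total = ≤-trans (cnt-∑ (suc r) Q (λ v e → not (A v) ∧ lookup e v) outside-A (subsets n))
        (∑-mono λ v → factor (not (A v)) v)
        where
        factor : ∀ b v → #subsets (λ e → Q e ∧ (b ∧ lookup e v)) ≤ ind b * f v
        factor true  v = ≤-reflexive (sym (+-identityʳ (f v)))
        factor false v = ≤-reflexive (#subsets-none (λ e → Q e ∧ false) (λ e t → proj₂ (∧-elim {Q e} t)))

    -- An edge with all its vertices known would be monochromatic within S.
    closed : ∀ {st p t d A Q c κ} → Invariant Γ p t d st → Family st A Q c 0 κ →
             0 < #subsets Q → ∀ S → ¬ T (p S)
    closed {st} {A = A} {Q} {c} inv fam X>0 S pS
      with cnt-witness Q (subsets n) X>0
    ... | e , Qe = proper inv S pS e (Q-edge fam e Qe) (λ v ev → proj₁ (colored v ev))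
      λ u v u∈ v∈ → trans (proj₂ (colored u (T-lookup e u∈))) (sym (proj₂ (colored v (T-lookup e v∈))))
      where
      e⊆A : ∀ v → T (lookup e v) → T (A v)
      e⊆A v ev with A v in Av
      ... | true  = tt
      ... | false = <-irrefl refl (begin-strict
        ∑ (ind ∘ A)        <⟨ ∑-mono-< (λ u → ind-mono {A u} (Q⊇A fam e Qe u)) v
                                (subst₂ _<_ (sym (cong ind Av)) (sym (ind-true ev)) ≤-refl) ⟩
        ∑ (ind ∘ lookup e) ≡⟨ edge-size e (Q-edge fam e Qe) ⟩
        q                  ≡⟨ A-size fam ⟨
        ∑ (ind ∘ A) + 0    ≡⟨ +-identityʳ _ ⟩
        ∑ (ind ∘ A)        ∎)
        where open ≤-Reasoning
      colored : ∀ v → T (lookup e v) → T (lookup S v) × χ S v ≡ c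
      colored v ev = subst (λ x → Compatible x (lookup S v) (χ S v)) (A-fixed fam v (e⊆A v ev)) (compat inv S pS v)

    -- Takes over when κ queries may have used up the density, n ≤ κ q z. The other two conditions
    -- carry the account of queries and of positive answers across the round.
    Continuation : ℕ → ℕ → Set
    Continuation d₀ t₀ = ∀ {p st t d κ} → Invariant Γ p t d st → κ + d ≡ d₀ → n ≤ κ * (q * z) →
                         t ≤ t₀ → Bound p t d

    exhausted : ∀ {p t st} → Invariant Γ p t 0 st → ∀ v X c → st v ≡ undecided X → ¬ T (X c)
    exhausted {st = st} inv v X c stv Xc = <-irrefl refl (<-≤-trans
      (weight-positive (undecided X) c refl Xc)
      (≤-trans (≤-reflexive (sym (cong weight stv))) (≤-trans (≤-∑ (weight ∘ st) v) (fuel inv))))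

    fixed-alive : ∀ {st : State} {v c x} → st v ≡ fixed x → T (palette st v c) → st v ≡ fixed c
    fixed-alive {c = c} {x} stv al = trans stv (cong fixed (sym (does-elim (c Fin.≟ x) (subst (λ y → T (alive y c)) stv al))))

    module _ {d₀ t₀} (K : Continuation d₀ t₀) where

      Goal : ℕ → ℕ → Set
      Goal d r = ∀ {p t st A Q c} κ → Invariant Γ p t d st → Family st A Q c r κ →
                 κ + d ≡ d₀ → t + r ≤ t₀ → Bound p t d

      -- Lexicographic recursion on (d , r): a query lowers d, while a popular vertex already fixed
      -- to `c` needs no query and lowers r. A positive answer raises t and lowers r, so t + r ≤ t₀
      -- persists.
      round-step : ∀ d r → (∀ d′ → d ≡ suc d′ → ∀ r → Goal d′ r) → (∀ r′ → r ≡ suc r′ → Goal d r′) → Goal d r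
      round-step d r ih-d ih-r κ inv fam eq t≤ with n ≤? κ * (q * z)
      ... | yes done = K inv eq done (≤-trans (m≤m+n _ r) t≤)
      round-step d zero ih-d ih-r {p} {t} κ inv fam eq t≤ | no small =
        bound-empty p {t} {d} (closed inv fam (nonempty fam small))
      round-step d (suc r) ih-d ih-r {st = st} {c = c} κ inv fam eq t≤ | no small
        with popular-vertex fam (nonempty fam small)
      ... | v , ¬Av , al , avg with st v in stv | d
      ...   | fixed x     | _ = ih-r r refl κ inv
        (grow fam v ¬Av avg (fixed-alive {st} stv (subst (λ y → T (alive y c)) (sym stv) al)) (λ _ _ → refl) ≤-refl)
        eq (≤-trans (+-monoʳ-≤ _ (n≤1+n r)) t≤)
      ...   | undecided X | zero   = ⊥-elim (exhausted inv v X c stv al)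
      ...   | undecided X | suc d′ = query inv v X c stv al
        (λ p′ inv′ → ih-d d′ refl r (suc κ) inv′
          (grow fam v ¬Av avg (set-same st v _) (set-other st v _) (n≤1+n κ))
          (trans (sym (+-suc κ d′)) eq) (≤-trans (≤-reflexive (sym (+-suc _ r))) t≤))
        (λ p′ inv′ → ih-d d′ refl (suc r) (suc κ) inv′ (drop fam v ¬Av (set-other st v _))
          (trans (sym (+-suc κ d′)) eq) t≤)

      round-inner : ∀ d → (∀ d′ → d ≡ suc d′ → ∀ r → Goal d′ r) → ∀ r → Goal d r
      round-inner d ih zero    = round-step d zero ih λ _ ()
      round-inner d ih (suc r) = round-step d (suc r) ih λ { _ refl → round-inner d ih r }

      round : ∀ d r → Goal d r
      round zero    = round-inner zero λ _ ()
      round (suc d) = round-inner (suc d) λ { _ refl → round d }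

  -- Repeating rounds until all degrees are below the threshold

  D-positive : 0 < D
  D-positive = C-positive q′ h

  n-positive : 0 < n
  n-positive = subst (0 <_) (sym n≡) (s≤s z≤n)

  Sparse : ℕ → State → Set
  Sparse z st = ∀ v c → degree (palette st) v c * z < D

  -- Every round makes at most q positive answers and at least n / (q z) queries,
  -- so between rounds t ≤ z q² w / n after w queries.
  module _ (z : ℕ) (Γ : Colors) (W : ℕ)
    (K : ∀ {p t d st w} → Invariant Γ p t d st → Sparse z st → t * n ≤ z * (q * q) * w → w + d ≡ W → Bound p t d)
    where

    open Round z Γ

    Scan : ℕ → Set
    Scan d = ∀ {p t st w} → Invariant Γ p t d st → t * n ≤ z * (q * q) * w → w + d ≡ W → Bound p t d

    after-round : ∀ d → (∀ {d′} → d′ < d → Scan d′) → ∀ {t w} → t * n ≤ z * (q * q) * w → w + d ≡ W →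
                  Continuation d (t + q)
    after-round d rec {t} {w} t≤ eq {t = t′} {d′} {κ} inv κ+d′≡d long t′≤ =
      rec d′<d inv account (trans (trans (+-assoc w κ d′) (cong (w +_) κ+d′≡d)) eq)
      where
      open ≤-Reasoning
      -- As n > 0, a finished round has made at least one query, so d has decreased and the
      -- recursion is well-founded.
      κ-positive : ∀ κ → n ≤ κ * (q * z) → 0 < κ
      κ-positive zero    n≤ = ⊥-elim (<-irrefl refl (<-≤-trans n-positive n≤))
      κ-positive (suc _) _  = s≤s z≤n
      d′<d : d′ < d
      d′<d = ≤-trans (+-monoˡ-≤ d′ (κ-positive κ long)) (≤-reflexive κ+d′≡d)
      e₁ : ∀ z q w κ → z * (q * q) * w + q * (κ * (q * z)) ≡ z * (q * q) * (w + κ)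
      e₁ = solve-∀
      account : t′ * n ≤ z * (q * q) * (w + κ)
      account = begin
        t′ * n                                    ≤⟨ *-monoˡ-≤ n t′≤ ⟩
        (t + q) * n                               ≡⟨ *-distribʳ-+ n t q ⟩
        t * n + q * n                             ≤⟨ +-mono-≤ t≤ (*-monoʳ-≤ q long) ⟩
        z * (q * q) * w + q * (κ * (q * z))       ≡⟨ e₁ z q w κ ⟩
        z * (q * q) * (w + κ)                     ∎

    alive-of-degree : ∀ {st v c} → D ≤ degree (palette st) v c * z → T (palette st v c)
    alive-of-degree {st} {v} {c} big =
      let e , t = cnt-witness (incident (palette st) v c) (subsets n) (positive (degree (palette st) v c) big)
      in incident-⊆ (palette st) v c e t v (incident-∋ (palette st) v c e t)
      where
      positive : ∀ x → D ≤ x * z → 0 < x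
      positive zero    D≤0 = <-≤-trans D-positive D≤0
      positive (suc _) _   = s≤s z≤n

    scan-step : ∀ d → (∀ {d′} → d′ < d → Scan d′) → Scan d
    scan-step d rec {st = st} inv t≤ eq
      with Fin.any? (λ v → Fin.any? λ c → D ≤? degree (palette st) v c * z)
    ... | no none = K inv (λ v c → ≰⇒> λ D≤ → none (v , c , D≤)) t≤ eq
    scan-step d rec {t = t} {st} inv t≤ eq | yes (v , c , big) with st v in stv | d
    ... | fixed x | d = round (after-round d rec t≤ eq) d q′ 0 inv
      (start big (fixed-alive {st} stv (alive-of-degree {st} big)) (λ _ _ → refl)) refl (+-monoʳ-≤ t (n≤1+n q′))
    ... | undecided X | zero  = ⊥-elim (exhausted inv v X c stv (subst (λ x → T (alive x c)) stv (alive-of-degree {st} big)))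
    ... | undecided X | suc d′ = query inv v X c stv (subst (λ x → T (alive x c)) stv (alive-of-degree {st} big))
      (λ p′ inv′ → round (after-round (suc d′) rec t≤ eq) d′ q′ 1 inv′
        (start big (set-same st v _) (set-other st v _)) refl (≤-reflexive (sym (+-suc t q′))))
      (λ p′ inv′ → rec ≤-refl inv′ (≤-trans t≤ (*-monoʳ-≤ (z * (q * q)) (n≤1+n _))) (trans (sym (+-suc _ d′)) eq))

    scan : ∀ d → Scan d
    scan = <-rec Scan scan-step

  -- Coloring the missed vertices, scale by scale

  missed : Colors → Fin n → Bool
  missed Γ v = not (does (Fin.any? λ c → T? (Γ v c)))

  missed-none : ∀ Γ v c → T (missed Γ v) → ¬ T (Γ v c)
  missed-none Γ v c m Γvc = not-elim m (does-intro (Fin.any? λ c → T? (Γ v c)) (c , Γvc))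

  Consistent : Colors → (Fin n → Fin k) → (Fin n → Fin k) → Set
  Consistent Γ ψ c = ∀ v → (T (missed Γ v) → c v ≡ ψ v) × (¬ T (missed Γ v) → T (Γ v (c v)))

  pick : Colors → (Fin n → Fin k) → Fin n → Fin k
  pick Γ ψ v with Fin.any? (λ c → T? (Γ v c))
  ... | yes (c , _) = c
  ... | no _        = ψ v

  pick-consistent : ∀ Γ ψ → Consistent Γ ψ (pick Γ ψ)
  pick-consistent Γ ψ v with Fin.any? (λ c → T? (Γ v c))
  ... | yes (c , Γvc) = (λ ()) , λ _ → Γvc
  ... | no _          = (λ _ → refl) , λ ¬m → ⊥-elim (¬m tt)

  MonoEdge : (Fin n → Fin k) → Subset n → Set
  MonoEdge c e = T (edge? H e) × Monochromatic c e

  Meets : (Fin n → Bool) → Subset n → Set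
  Meets M e = ∃ λ v → T (lookup e v) × T (M v)

  module _ (a : ℕ) where

    -- `ψ` settles the colors of the missed vertices for good. The bound ranges over all consistent
    -- `c` because the other vertices get their colors only at later scales. Edge counts are
    -- multiplied by `a` to avoid division.
    Checkpoint : ℕ → Colors → Set
    Checkpoint β Γ = ∃ λ ψ → ∀ c → Consistent Γ ψ c → ∀ Q →
      (∀ e → T (Q e) → MonoEdge c e × Meets (missed Γ) e) → a * #subsets Q ≤ β

    -- A monochromatic edge that avoids the vertices missed by Γ lies in Γ, so
    -- it is counted by the degree of any of its vertices.
    mono-edges-≤ : ∀ {β Γ} ((ψ , _) : Checkpoint β Γ) c → Consistent Γ ψ c → ∀ M Q →
      (∀ e → T (Q e) → MonoEdge c e × Meets M e) →
      a * #subsets Q ≤ β + a * ∑ (λ v → ind (M v) * degree Γ v (c v))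
    mono-edges-≤ {β} {Γ} (ψ , old) c con M Q mono = begin
      a * #subsets Q                    ≤⟨ *-monoʳ-≤ a (cnt-⊎ split (subsets n)) ⟩
      a * (#subsets Q₁ + #subsets Q₀)   ≡⟨ *-distribˡ-+ a (#subsets Q₁) (#subsets Q₀) ⟩
      a * #subsets Q₁ + a * #subsets Q₀ ≤⟨ +-mono-≤ (old c con Q₁ in-Q₁) (*-monoʳ-≤ a new) ⟩
      β + a * ∑ (λ v → ind (M v) * degree Γ v (c v)) ∎
      where
      open ≤-Reasoning
      meets? : ∀ e → Dec (Meets (missed Γ) e)
      meets? e = Fin.any? λ v → T? (lookup e v) ×-dec T? (missed Γ v)
      Q₁ Q₀ : Subset n → Bool
      Q₁ e = Q e ∧ does (meets? e)
      Q₀ e = Q e ∧ not (does (meets? e))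
      split : ∀ e → T (Q e) → T (Q₁ e) ⊎ T (Q₀ e)
      split e Qe with does (meets? e)
      ... | true  = inj₁ (∧-intro Qe tt)
      ... | false = inj₂ (∧-intro Qe tt)
      in-Q₁ : ∀ e → T (Q₁ e) → MonoEdge c e × Meets (missed Γ) e
      in-Q₁ e t = let Qe , me = ∧-elim {Q e} t in proj₁ (mono e Qe) , does-elim (meets? e) me
      covered : ∀ e → T (Q₀ e) → ∃ λ v → T (M v ∧ incident Γ v (c v) e)
      covered e t =
        let Qe , ¬me = ∧-elim {Q e} t
            (He , me) , v , ev , Mv = mono e Qe
        in v , ∧-intro Mv (incident-intro Γ v (c v) e He ev λ u eu →
             subst (T ∘ Γ u) (me u v (∈-lookup e eu) (∈-lookup e ev))
                   (proj₂ (con u) λ mu → not-elim ¬me (does-intro (meets? e) (u , eu , mu))))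
      factor : ∀ b v → #subsets (λ e → Q₀ e ∧ (b ∧ incident Γ v (c v) e)) ≤ ind b * degree Γ v (c v)
      factor true  v = ≤-trans (cnt-mono (λ e t → proj₂ (∧-elim {Q₀ e} t)) (subsets n)) (≤-reflexive (sym (+-identityʳ _)))
      factor false v = ≤-reflexive (#subsets-none (λ e → Q₀ e ∧ false) λ e t → proj₂ (∧-elim {Q₀ e} t))
      new : #subsets Q₀ ≤ ∑ (λ v → ind (M v) * degree Γ v (c v))
      new = begin
        #subsets Q₀     ≡⟨ *-identityˡ _ ⟨
        1 * #subsets Q₀ ≤⟨ cnt-∑ 1 Q₀ (λ v e → M v ∧ incident Γ v (c v) e)
                             (λ e t → let v , t′ = covered e t in
                                ≤-trans (≤-reflexive (sym (ind-true t′))) (≤-∑ (λ v → ind (M v ∧ incident Γ v (c v) e)) v))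
                             (subsets n) ⟩
        ∑ (λ v → #subsets (λ e → Q₀ e ∧ (M v ∧ incident Γ v (c v) e))) ≤⟨ ∑-mono (λ v → factor (M v) v) ⟩
        ∑ (λ v → ind (M v) * degree Γ v (c v)) ∎

    -- A vertex missed by Γ′ but not by Γ takes a color possible in Γ, so a coloring consistent with
    -- Γ′ is consistent with Γ and the old bound covers the edges that meet the old missed set. The
    -- remaining ones are counted by degrees in Γ, not in Γ′.
    next-checkpoint : ∀ {β Γ Γ′ δ} → (∀ v c → T (Γ′ v c) → T (Γ v c)) → Checkpoint β Γ →
      (∀ (c : Fin n → Fin k) → a * ∑ (λ v → ind (missed Γ′ v) * degree Γ v (c v)) ≤ δ) → Checkpoint (β + δ) Γ′
    next-checkpoint {β} {Γ} {Γ′} Γ′⊆Γ chk@(ψ , _) cost = pick Γ ψ , λ c con Q mono →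
      ≤-trans (mono-edges-≤ chk c (consistent c con) (missed Γ′) Q mono) (+-monoʳ-≤ β (cost c))
      where
      consistent : ∀ c → Consistent Γ′ (pick Γ ψ) c → Consistent Γ ψ c
      consistent c con v with T? (missed Γ′ v)
      ... | yes m′ = subst (λ x → (T (missed Γ v) → x ≡ ψ v) × (¬ T (missed Γ v) → T (Γ v x)))
                           (sym (proj₁ (con v) m′)) (pick-consistent Γ ψ v)
      ... | no ¬m′ = (λ m → ⊥-elim (missed-none Γ v (c v) m al)) , λ _ → al
        where
        al : T (Γ v (c v))
        al = Γ′⊆Γ v (c v) (proj₂ (con v) ¬m′)

    weighted-degrees-≤ : ∀ {Γ z x} → (∀ v c → degree Γ v c * z ≤ x) → ∀ M (c : Fin n → Fin k) →
      ∑ (λ v → ind (M v) * degree Γ v (c v)) * z ≤ ∑ (ind ∘ M) * x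
    weighted-degrees-≤ {Γ} {z} {x} bound M c = begin
      ∑ (λ v → ind (M v) * degree Γ v (c v)) * z       ≡⟨ *-comm _ z ⟩
      z * ∑ (λ v → ind (M v) * degree Γ v (c v))       ≡⟨ ∑-*ˡ z (λ v → ind (M v) * degree Γ v (c v)) ⟨
      ∑ (λ v → z * (ind (M v) * degree Γ v (c v)))     ≤⟨ ∑-mono (λ v → term v) ⟩
      ∑ (λ v → x * ind (M v))                          ≡⟨ ∑-*ˡ x (ind ∘ M) ⟩
      x * ∑ (ind ∘ M)                                  ≡⟨ *-comm x _ ⟩
      ∑ (ind ∘ M) * x                                  ∎
      where
      open ≤-Reasoning
      e₁ : ∀ z i d → z * (i * d) ≡ d * z * i
      e₁ = solve-∀
      term : ∀ v → z * (ind (M v) * degree Γ v (c v)) ≤ x * ind (M v)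
      term v = ≤-trans (≤-reflexive (e₁ z (ind (M v)) (degree Γ v (c v)))) (*-monoˡ-≤ (ind (M v)) (bound v (c v)))

    -- At scale i, t + 1 ≤ 2^i b: the queries give t ≤ 2^i k q², and the 2 in `b` absorbs the 1. `W`
    -- counts all pairs (v , c). `B` is `a` times the number of edges that one scale may spoil:
    -- fewer than n 2^i b / a missed vertices, each of degree at most 2 D / 2^i.
    b W B : ℕ
    b = 2 * (k * (q * q))
    W = k * n
    B = n * b * (2 * D)

    rebase : ∀ {Γ p t d st} → Invariant Γ p t d st → Invariant (palette st) p t d st
    rebase inv = record
      { proper = proper inv ; size = size inv ; compat = compat inv
      ; count = count inv ; fuel = fuel inv ; below = λ _ _ t → t }

    2^-nonZero : ∀ i → NonZero (2 ^ i)
    2^-nonZero i = m^n≢0 2 i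

    module _ (F I : ℕ) .{{_ : NonZero a}} (c₀ : Fin k)
      (many-scales : 4 * F * q ≤ 2 ^ I)
      (a-large : 4 * F * (suc I * (4 * (k * (q * (q * q))))) ≤ a)
      (far : ∀ (c : Fin n → Fin k) → ∃ λ Q → (∀ e → T (Q e) → MonoEdge c e) × n C q ≤ F * #subsets Q)
      (leaf : ∀ {Γ p t d st} → Invariant Γ p t d st → n * suc t ≤ a * ∑ (ind ∘ missed (palette st)) → Bound p t d)
      where

      nD≡ : n * D ≡ q * (n C q)
      nD≡ = subst (λ n → n * D ≡ q * (n C q)) (sym n≡) (sym (C-absorb (q′ + h) q′))

      -- Being far gives at least C(n, q) / F monochromatic edges. Those meeting missed vertices
      -- number at most C(n, q) / (4 F) by the size of `a`. The others are at most n D / 2^I = q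
      -- C(n, q) / 2^I, again at most C(n, q) / (4 F).
      far-contradiction : ∀ {Γ} → Checkpoint (suc I * B) Γ → (∀ v c → degree Γ v c * 2 ^ I ≤ D) → ⊥
      far-contradiction {Γ} chk@(ψ , _) deg
        with far (pick Γ ψ)
      ... | Q , mono , Cn≤ = <-irrefl refl (begin-strict
        2 * (a * Cn)                        <⟨ *-monoˡ-< (a * Cn) {{ℕ.>-nonZero aCn>0}} {2} {4} (s≤s (s≤s (s≤s z≤n))) ⟩
        4 * (a * Cn)                        ≤⟨ *-monoʳ-≤ 4 (*-monoʳ-≤ a Cn≤) ⟩
        4 * (a * (F * #subsets Q))          ≡⟨ e₁ a F (#subsets Q) ⟩
        4 * F * (a * #subsets Q)
          ≤⟨ *-monoʳ-≤ (4 * F) (mono-edges-≤ chk c (pick-consistent Γ ψ) (λ _ → true) Q λ e Qe → mono e Qe , meets e Qe) ⟩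
        4 * F * (suc I * B + a * Y)         ≡⟨ *-distribˡ-+ (4 * F) (suc I * B) (a * Y) ⟩
        4 * F * (suc I * B) + 4 * F * (a * Y) ≤⟨ +-mono-≤ early late ⟩
        a * Cn + a * Cn                     ≡⟨ e₂ (a * Cn) ⟩
        2 * (a * Cn)                        ∎)
        where
        open ≤-Reasoning
        c : Fin n → Fin k
        c = pick Γ ψ
        Cn Y : ℕ
        Cn = n C q
        Y = ∑ (λ v → 1 * degree Γ v (c v))
        aCn>0 : 0 < a * Cn
        aCn>0 = *-mono-≤ (ℕ.>-nonZero⁻¹ a) (ℕ.>-nonZero⁻¹ _ {{C-nonZero (≤-trans (m≤m+n q h) (≤-reflexive (sym n≡)))}})
        meets : ∀ e → T (Q e) → Meets (λ _ → true) e
        meets e Qe with Fin.any? (λ v → T? (lookup e v) ×-dec T? true)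
        ... | yes m = m
        ... | no ¬m = ⊥-elim (1+n≢0 (trans (sym (edge-size e (proj₁ (mono e Qe))))
                         (n≤0⇒n≡0 (≤-trans (∑-mono λ v → ind-mono {lookup e v} {false} (λ ev → ¬m (v , ev , tt)))
                                           (≤-reflexive (trans (∑-const n 0) (*-zeroʳ n)))))))
        e₁ : ∀ a F x → 4 * (a * (F * x)) ≡ 4 * F * (a * x)
        e₁ = solve-∀
        e₂ : ∀ x → x + x ≡ 2 * x
        e₂ = solve-∀
        e₃ : ∀ n k q D → n * (2 * (k * (q * q))) * (2 * D) ≡ 4 * (k * (q * q)) * (n * D)
        e₃ = solve-∀
        e₄ : ∀ k q c → 4 * (k * (q * q)) * (q * c) ≡ 4 * (k * (q * (q * q))) * c
        e₄ = solve-∀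
        B≡ : B ≡ 4 * (k * (q * (q * q))) * Cn
        B≡ = trans (e₃ n k q D) (trans (cong (4 * (k * (q * q)) *_) nD≡) (e₄ k q Cn))
        early : 4 * F * (suc I * B) ≤ a * Cn
        early = begin
          4 * F * (suc I * B)                                 ≡⟨ cong (λ x → 4 * F * (suc I * x)) B≡ ⟩
          4 * F * (suc I * (4 * (k * (q * (q * q))) * Cn))    ≡⟨ cong (4 * F *_) (*-assoc (suc I) (4 * (k * (q * (q * q)))) Cn) ⟨
          4 * F * (suc I * (4 * (k * (q * (q * q)))) * Cn)    ≡⟨ *-assoc (4 * F) _ Cn ⟨
          4 * F * (suc I * (4 * (k * (q * (q * q))))) * Cn    ≤⟨ *-monoˡ-≤ Cn a-large ⟩
          a * Cn                                              ∎
        e₅ : ∀ F a Y z → 4 * F * (a * Y) * z ≡ 4 * F * a * (Y * z)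
        e₅ = solve-∀
        e₆ : ∀ F a q c → 4 * F * a * (q * c) ≡ a * c * (4 * F * q)
        e₆ = solve-∀
        late : 4 * F * (a * Y) ≤ a * Cn
        late = *-cancelʳ-≤ _ _ (2 ^ I) {{2^-nonZero I}} (begin
          4 * F * (a * Y) * 2 ^ I               ≡⟨ e₅ F a Y (2 ^ I) ⟩
          4 * F * a * (Y * 2 ^ I)
            ≤⟨ *-monoʳ-≤ (4 * F * a) (weighted-degrees-≤ {Γ} deg (λ _ → true) c) ⟩
          4 * F * a * (∑ {n} (λ _ → 1) * D)     ≡⟨ cong (λ x → 4 * F * a * (x * D)) (trans (∑-const n 1) (*-identityʳ n)) ⟩
          4 * F * a * (n * D)                   ≡⟨ cong (4 * F * a *_) nD≡ ⟩
          4 * F * a * (q * Cn)                  ≡⟨ e₆ F a q Cn ⟩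
          a * Cn * (4 * F * q)                  ≤⟨ *-monoʳ-≤ (a * Cn) many-scales ⟩
          a * Cn * 2 ^ I                        ∎)

      scale-leaf : ∀ {Γ p t d st w} i → Invariant Γ p t d st → t * n ≤ 2 ^ i * (q * q) * w → w + d ≡ W →
        n * 2 ^ i * b ≤ a * ∑ (ind ∘ missed (palette st)) → Bound p t d
      scale-leaf {t = t} {d} {w = w} i inv t≤ eq enough = leaf inv (begin
        n * suc t                       ≡⟨ e₁ n t ⟩
        t * n + n                       ≤⟨ +-mono-≤ (≤-trans t≤ (*-monoʳ-≤ (2 ^ i * (q * q)) w≤)) one ⟩
        2 ^ i * (q * q) * (k * n) + 2 ^ i * (q * q) * k * n ≡⟨ e₂ (2 ^ i) (q * q) k n ⟩
        n * 2 ^ i * b                   ≤⟨ enough ⟩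
        _                               ∎)
        where
        open ≤-Reasoning
        w≤ : w ≤ k * n
        w≤ = ≤-trans (m≤m+n w d) (≤-reflexive eq)
        k-positive : 0 < k
        k-positive = ≤-<-trans z≤n (Fin.toℕ<n c₀)
        one : n ≤ 2 ^ i * (q * q) * k * n
        one = ≤-trans (≤-reflexive (sym (*-identityˡ n)))
                (*-monoˡ-≤ n (*-mono-≤ (*-mono-≤ (ℕ.>-nonZero⁻¹ _ {{2^-nonZero i}}) (s≤s z≤n)) k-positive))
        e₁ : ∀ n t → n * suc t ≡ t * n + n
        e₁ = solve-∀
        e₂ : ∀ z x k n → z * x * (k * n) + z * x * k * n ≡ n * z * (2 * (k * x))
        e₂ = solve-∀

      -- The degree bound 2 D / 2^i is the sparseness left by scale i - 1; at i = 0 it follows from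
      -- `degree-≤`. Each scale ends in a leaf or passes its checkpoint on; after scale I the latter
      -- contradicts being far.
      scales : ∀ j i → i + j ≡ I → ∀ Γ → Checkpoint (i * B) Γ → (∀ v c → degree Γ v c * 2 ^ i ≤ 2 * D) →
        ∀ {p t d st w} → Invariant Γ p t d st → t * n ≤ 2 ^ i * (q * q) * w → w + d ≡ W → Bound p t d
      scales j i i+j≡I Γ chk deg {d = d} = scan (2 ^ i) Γ W finish d
        where
        open ≤-Reasoning
        finish : ∀ {p t d st w} → Invariant Γ p t d st → Sparse (2 ^ i) st →
          t * n ≤ 2 ^ i * (q * q) * w → w + d ≡ W → Bound p t d
        finish {p} {t} {d} {st} {w} inv sparse t≤ eq with n * 2 ^ i * b ≤? a * ∑ (ind ∘ missed (palette st))
        ... | yes enough = scale-leaf i inv t≤ eq enough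
        ... | no few = continue j i+j≡I
          where
          Γ′ : Colors
          Γ′ = palette st
          e₁ : ∀ n z b D → n * z * b * (2 * D) ≡ n * b * (2 * D) * z
          e₁ = solve-∀
          cost : ∀ (c : Fin n → Fin k) → a * ∑ (λ v → ind (missed Γ′ v) * degree Γ v (c v)) ≤ B
          cost c = *-cancelʳ-≤ _ _ (2 ^ i) {{2^-nonZero i}} (begin
            a * ∑ (λ v → ind (missed Γ′ v) * degree Γ v (c v)) * 2 ^ i   ≡⟨ *-assoc a _ (2 ^ i) ⟩
            a * (∑ (λ v → ind (missed Γ′ v) * degree Γ v (c v)) * 2 ^ i)
              ≤⟨ *-monoʳ-≤ a (weighted-degrees-≤ {Γ} deg (missed Γ′) c) ⟩
            a * (∑ (ind ∘ missed Γ′) * (2 * D))                          ≡⟨ *-assoc a _ (2 * D) ⟨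
            a * ∑ (ind ∘ missed Γ′) * (2 * D)                            ≤⟨ *-monoˡ-≤ (2 * D) (<⇒≤ (≰⇒> few)) ⟩
            n * 2 ^ i * b * (2 * D)                                      ≡⟨ e₁ n (2 ^ i) b D ⟩
            B * 2 ^ i                                                    ∎)
          chk′ : Checkpoint (suc i * B) Γ′
          chk′ = subst (λ β → Checkpoint β Γ′) (+-comm (i * B) B) (next-checkpoint {Γ = Γ} {Γ′} (below inv) chk cost)
          e₂ : ∀ x z → x * (2 * z) ≡ 2 * (x * z)
          e₂ = solve-∀
          continue : ∀ j → i + j ≡ I → Bound p t d
          continue zero    i≡I = ⊥-elim (contradict (trans (sym (+-identityʳ i)) i≡I))
            where
            contradict : i ≡ I → ⊥
            contradict refl = far-contradiction chk′ λ v c → <⇒≤ (sparse v c)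
          continue (suc j) eq′ = scales j (suc i) (trans (sym (+-suc i j)) eq′) Γ′ chk′
            (λ v c → ≤-trans (≤-reflexive (e₂ (degree Γ′ v c) (2 ^ i))) (*-monoʳ-≤ 2 (<⇒≤ (sparse v c))))
            (rebase inv) (≤-trans t≤ (*-monoˡ-≤ w (*-monoˡ-≤ (q * q) (m≤m+n (2 ^ i) _)))) eq

      process-bound : ∀ p → (∀ S → T (p S) → ProperOn H S (χ S)) → (∀ S → T (p S) → ∣ S ∣ ≡ s) → Bound p 0 W
      process-bound p prop sz = scales I 0 refl (λ _ _ → true) start-checkpoint
        (λ v c → ≤-trans (≤-reflexive (*-identityʳ _)) (≤-trans (degree-≤ (λ _ _ → true) v c) (m≤m+n D _)))
        {st = λ _ → undecided λ _ → true} {w = 0}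
        (record { proper = prop ; size = sz ; compat = λ _ _ _ _ → tt
                ; count = trans (∑-const n 0) (*-zeroʳ n)
                ; fuel = ≤-reflexive (trans (∑-const n _) (trans (cong (n *_) (trans (∑-const k 1) (*-identityʳ k))) (*-comm n k)))
                ; below = λ _ _ _ → tt })
        z≤n refl
        where
        start-checkpoint : Checkpoint 0 (λ _ _ → true)
        start-checkpoint = (λ _ → c₀) , λ c con Q mono → ≤-reflexive (trans
          (cong (a *_) (#subsets-none Q λ e Qe → let _ , v , _ , m = mono e Qe in missed-none (λ _ _ → true) v c₀ m tt))
          (*-zeroʳ a))

-- The sample size

nonZero-* : ∀ {x y} → 0 < x * y → NonZero y
nonZero-* {x} {zero}  lt = ⊥-elim (<-irrefl refl (subst (0 <_) (*-zeroʳ x) lt))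
nonZero-* {x} {suc _} _  = _

module Soundness
  {q′ n k : ℕ} (H : Hypergraph (suc q′) n) (h : ℕ) (n≡ : n ≡ suc q′ + h)
  (χ : Subset n → Fin n → Fin k) (c₀ : Fin k) (c F I L s : ℕ) .{{_ : NonZero c}} .{{_ : NonZero L}}
  (2≤L : 2 ≤ L) (s≡ : s ≡ 2 * (suc c * L)) (s≤n : s ≤ n) (fine : 2 * k * s ≤ 2 ^ L)
  where

  -- y is twice the largest possible number of queries, which keeps (1 + 1/y)^(k n) at most 2.
  y N : ℕ
  y = k * n + k * n
  N = n C s

  open Process H h n≡ χ s y N
  open Invariant

  -- All samples in `p` contain the t fixed vertices and avoid the missed ones, so `avoid-count-≤`
  -- applies with 2 k n = y, and 2^L ≥ 4 supplies the 4 in `Bound`.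
  leaf : ∀ {Γ p t d st} → Invariant Γ p t d st → n * suc t ≤ suc c * ∑ (ind ∘ missed (palette st)) → Bound p t d
  leaf {Γ} {p} {t} {d} {st} inv enough = begin
    #subsets p * (4 * y ^ t * y ^ d)       ≤⟨ *-monoˡ-≤ _ count-≤ ⟩
    (f C u) * (4 * y ^ t * y ^ d)
      ≤⟨ *-monoʳ-≤ (f C u) (*-monoˡ-≤ (y ^ d) (*-monoˡ-≤ (y ^ t) (^-monoʳ-≤ 2 2≤L))) ⟩
    (f C u) * (2 ^ L * y ^ t * y ^ d)      ≡⟨ e₁ (f C u) (2 ^ L) (y ^ t) (y ^ d) ⟩
    (f C u) * 2 ^ L * y ^ t * y ^ d        ≤⟨ *-mono-≤ small (^-monoˡ-≤ d (n≤1+n y)) ⟩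
    N * suc y ^ d                          ∎
    where
    open ≤-Reasoning
    M Fx : Fin n → Bool
    M  = missed (palette st)
    Fx = isFixed ∘ st
    m f u : ℕ
    m = ∑ (ind ∘ M)
    f = free Fx M
    u = s ∸ t
    e₁ : ∀ a b c d → a * (b * c * d) ≡ a * b * c * d
    e₁ = solve-∀
    fixed-not-missed : ∀ v → T (Fx v) → ¬ T (M v)
    fixed-not-missed v Fv Mv = let c , al = has-color (st v) Fv in missed-none (palette st) v c Mv al
      where
      has-color : ∀ x → T (isFixed x) → ∃ λ c → T (alive x c)
      has-color (fixed c) _ = c , does-intro (c Fin.≟ c) refl
    partition : f + t + m ≡ n
    partition = begin-equality
      f + t + m                                 ≡⟨ cong (λ x → f + x + m) (count inv) ⟨
      f + ∑ (ind ∘ Fx) + m                      ≡⟨ cong (_+ m) (∑-+ (λ v → ind (not (Fx v) ∧ not (M v))) (ind ∘ Fx)) ⟨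
      ∑ (λ v → ind (not (Fx v) ∧ not (M v)) + ind (Fx v)) + m
        ≡⟨ ∑-+ (λ v → ind (not (Fx v) ∧ not (M v)) + ind (Fx v)) (ind ∘ M) ⟨
      ∑ (λ v → ind (not (Fx v) ∧ not (M v)) + ind (Fx v) + ind (M v))
        ≡⟨ ∑-cong (λ v → one (Fx v) (M v) (fixed-not-missed v)) ⟩
      ∑ {n} (λ _ → 1)                           ≡⟨ trans (∑-const n 1) (*-identityʳ n) ⟩
      n                                         ∎
      where
      one : ∀ a b → (T a → ¬ T b) → ind (not a ∧ not b) + ind a + ind b ≡ 1
      one true  true  a∌b = ⊥-elim (a∌b tt tt)
      one true  false _   = refl
      one false true  _   = refl
      one false false _   = refl
    m≤n : m ≤ n
    m≤n = ≤-trans (m≤n+m m (f + t)) (≤-reflexive partition)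
    -- From n (t + 1) ≤ a m ≤ a n. Hence t ≤ a L, and of the s = 2 a L sampled vertices at least a L
    -- remain besides the fixed ones.
    t<a : suc t ≤ suc c
    t<a = *-cancelˡ-≤ n {{ℕ.>-nonZero n-positive}}
      (≤-trans enough (≤-trans (*-monoʳ-≤ (suc c) m≤n) (≤-reflexive (*-comm (suc c) n))))
    e₂ : ∀ x → 2 * x ≡ x + x
    e₂ = solve-∀
    s≡′ : s ≡ suc c * L + suc c * L
    s≡′ = trans s≡ (e₂ (suc c * L))
    t≤aL : t ≤ suc c * L
    t≤aL = ≤-trans (≤-pred (m≤n⇒m≤1+n t<a)) (m≤m*n (suc c) L)
    t+u≡s : t + u ≡ s
    t+u≡s = m+[n∸m]≡n (≤-trans t≤aL (≤-trans (m≤m+n _ (suc c * L)) (≤-reflexive (sym s≡′))))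
    long : suc c * L ≤ u
    long = +-cancelˡ-≤ t _ _ (≤-trans (+-monoˡ-≤ (suc c * L) t≤aL) (≤-reflexive (trans (sym s≡′) (sym t+u≡s))))
    count-≤ : #subsets p ≤ f C u
    count-≤ = #subsets-between Fx M u p
      (λ S pS → trans (size inv S pS) (trans (sym t+u≡s) (cong (_+ u) (sym (count inv)))))
      (λ S pS v → fixed-in (st v) (compat inv S pS v))
      (λ S pS v Mv Sv → missed-none (palette st) v (χ S v) Mv (compat-alive (st v) Sv (compat inv S pS v)))
      where
      fixed-in : ∀ x {b c} → Compatible x b c → T (isFixed x) → T b
      fixed-in (fixed _) = λ (b , _) _ → b
      fixed-in (undecided _) _ ()
      compat-alive : ∀ x {b c} → T b → Compatible x b c → T (alive x c)
      compat-alive (fixed x)     {c = c} _ (_ , refl) = does-intro (c Fin.≟ c) refl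
      compat-alive (undecided _) b com = com b
    y≡ : 2 * k * (f + t + m) ≡ y
    y≡ = trans (cong (2 * k *_) partition) (e₃ k n)
      where
      e₃ : ∀ k n → 2 * k * n ≡ k * n + k * n
      e₃ = solve-∀
    small : (f C u) * 2 ^ L * y ^ t ≤ N
    small = subst₂ (λ y N → (f C u) * 2 ^ L * y ^ t ≤ N) y≡ (cong₂ _C_ partition t+u≡s)
      (avoid-count-≤ c k L f t m {{nonZero-* {suc c} (<-≤-trans (*-mono-≤ n-positive (s≤s z≤n)) enough)}} u
        (≤-trans (≤-reflexive (cong (_* suc t) partition)) enough)
        long
        (subst₂ _≤_ (sym t+u≡s) (sym partition) s≤n)
        (subst (λ s → 2 * k * s ≤ 2 ^ L) (sym t+u≡s) fine))

  -- At the root t = 0 and d = k n, so the bound is (1 + 1/(2 k n))^(k n) / 4 ≤ 2 / 4.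
  accepted-≤-half :
    4 * F * suc q′ ≤ 2 ^ I → 4 * F * (suc I * (4 * (k * (suc q′ * (suc q′ * suc q′))))) ≤ suc c →
    (∀ (c : Fin n → Fin k) → ∃ λ Q → (∀ e → T (Q e) → T (edge? H e) × Monochromatic c e) × n C suc q′ ≤ F * #subsets Q) →
    ∀ p → (∀ S → T (p S) → ProperOn H S (χ S)) → (∀ S → T (p S) → ∣ S ∣ ≡ s) → 2 * #subsets p ≤ N
  accepted-≤-half many-scales a-large far p prop sz =
    *-cancelʳ-≤ _ _ (2 * y ^ (k * n)) {{m*n≢0 2 (y ^ (k * n)) {{_}} {{m^n≢0 y (k * n) {{y-nonZero}}}}}} (begin
      2 * #subsets p * (2 * y ^ (k * n))              ≡⟨ e₁ (#subsets p) (y ^ (k * n)) ⟩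
      #subsets p * (4 * 1 * y ^ (k * n))
        ≤⟨ process-bound (suc c) F I c₀ many-scales a-large far (λ {Γ} → leaf {Γ}) p prop sz ⟩
      N * suc y ^ (k * n)                             ≤⟨ *-monoʳ-≤ N (compound-≤-double (k * n)) ⟩
      N * (2 * y ^ (k * n))                           ∎)
    where
    open ≤-Reasoning
    e₁ : ∀ p y → 2 * p * (2 * y) ≡ p * (4 * 1 * y)
    e₁ = solve-∀
    kn>0 : 0 < k * n
    kn>0 = *-mono-≤ (≤-<-trans z≤n (Fin.toℕ<n c₀)) n-positive
    y-nonZero : NonZero y
    y-nonZero = ℕ.>-nonZero (≤-trans kn>0 (m≤m+n (k * n) (k * n)))

-- The constants: a = 448 k q³ m Λ and L = 26 Λ, with W = k q m, suffice for the
-- process with Λ + 5 scales.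
module Parameters (q k m Λ : ℕ) .{{_ : NonZero q}} .{{_ : NonZero k}} .{{_ : NonZero m}} .{{_ : NonZero Λ}}
  (W-upper : k * q * m < 2 ^ suc Λ) where

  open ≤-Reasoning

  -- The 5 is 4 + 1: a factor 16 = 2^4, and one more from k q m < 2^(Λ + 1).
  scales-suffice : 4 * (4 * m) * q ≤ 2 ^ (5 + Λ)
  scales-suffice = begin
    4 * (4 * m) * q          ≡⟨ e₁ m q ⟩
    16 * (1 * (q * m))       ≤⟨ *-monoʳ-≤ 16 (*-monoˡ-≤ (q * m) (ℕ.>-nonZero⁻¹ k)) ⟩
    16 * (k * (q * m))       ≡⟨ cong (16 *_) (*-assoc k q m) ⟨
    16 * (k * q * m)         ≤⟨ *-monoʳ-≤ 16 (<⇒≤ W-upper) ⟩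
    16 * (2 * 2 ^ Λ)         ≡⟨ e₂ (2 ^ Λ) ⟩
    2 ^ 5 * 2 ^ Λ            ≡⟨ ^-distribˡ-+-* 2 5 Λ ⟨
    2 ^ (5 + Λ)              ∎
    where
    e₁ : ∀ m q → 4 * (4 * m) * q ≡ 16 * (1 * (q * m))
    e₁ = solve-∀
    e₂ : ∀ x → 16 * (2 * x) ≡ 32 * x
    e₂ = solve-∀

  X : ℕ
  X = m * (k * (q * (q * q))) * Λ

  -- 64 collects the three factors 4, and 7 comes from 6 + Λ ≤ 7 Λ.
  a-suffices : ∀ α → 64 * 7 ≤ α → 4 * (4 * m) * (suc (5 + Λ) * (4 * (k * (q * (q * q))))) ≤ α * X
  a-suffices α 448≤α = begin
    4 * (4 * m) * ((6 + Λ) * (4 * (k * (q * (q * q)))))  ≡⟨ e₁ m (6 + Λ) (k * (q * (q * q))) ⟩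
    64 * (m * (k * (q * (q * q))) * (6 + Λ))
      ≤⟨ *-monoʳ-≤ 64 (*-monoʳ-≤ (m * (k * (q * (q * q)))) (+-monoˡ-≤ Λ (m≤m*n 6 Λ))) ⟩
    64 * (m * (k * (q * (q * q))) * (6 * Λ + Λ))         ≡⟨ e₂ 64 (m * (k * (q * (q * q)))) Λ ⟩
    64 * 7 * X                                           ≤⟨ *-monoˡ-≤ X 448≤α ⟩
    α * X                                                ∎
    where
    e₁ : ∀ m l x → 4 * (4 * m) * (l * (4 * x)) ≡ 64 * (m * x * l)
    e₁ = solve-∀
    e₂ : ∀ c x l → c * (x * (6 * l + l)) ≡ c * 7 * (x * l)
    e₂ = solve-∀

  -- With z = 2^Λ, the constant is at most z^16, the cube of k q m < 2 z ≤ z² is at most z^6, and Λ²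
  -- ≤ z²; hence 24 = 16 + 6 + 2.
  fine-suffices : ∀ α ℓ → α * ℓ * 4 ≤ 2 ^ 16 → 24 ≤ ℓ → 2 * k * (2 * (α * X * (ℓ * Λ))) ≤ 2 ^ (ℓ * Λ)
  fine-suffices α ℓ α-small 24≤ℓ = begin
    2 * k * (2 * (α * X * (ℓ * Λ)))
      ≡⟨ e₁ k m q Λ α ℓ ⟩
    α * ℓ * 4 * (k * k * (q * q * q) * m * (Λ * Λ))
      ≤⟨ *-mono-≤ α-small (*-mono-≤ cube (*-mono-≤ (<⇒≤ (n<2^n Λ)) (<⇒≤ (n<2^n Λ)))) ⟩
    2 ^ 16 * (w * w * w * (2 ^ Λ * 2 ^ Λ))
      ≤⟨ *-mono-≤ (^-monoʳ-≤ 2 (m≤m*n 16 Λ)) (*-monoˡ-≤ (2 ^ Λ * 2 ^ Λ) (*-mono-≤ (*-mono-≤ w≤ w≤) w≤)) ⟩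
    2 ^ (16 * Λ) * (z * z * (z * z) * (z * z) * (z * z))
      ≡⟨ cong₂ _*_ (trans (cong (2 ^_) (*-comm 16 Λ)) (sym (^-*-assoc 2 Λ 16))) (e₂ z) ⟩
    z ^ 16 * z ^ 8       ≡⟨ ^-distribˡ-+-* z 16 8 ⟨
    z ^ 24               ≤⟨ ^-monoʳ-≤ z {{m^n≢0 2 Λ}} 24≤ℓ ⟩
    z ^ ℓ                ≡⟨ ^-*-assoc 2 Λ ℓ ⟩
    2 ^ (Λ * ℓ)          ≡⟨ cong (2 ^_) (*-comm Λ ℓ) ⟩
    2 ^ (ℓ * Λ)          ∎
    where
    w z : ℕ
    w = k * q * m
    z = 2 ^ Λ
    w≤ : w ≤ z * z
    w≤ = ≤-trans (<⇒≤ W-upper) (*-monoˡ-≤ (2 ^ Λ) (^-monoʳ-≤ 2 {1} (ℕ.>-nonZero⁻¹ Λ)))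
    cube : k * k * (q * q * q) * m ≤ w * w * w
    cube = begin
      k * k * (q * q * q) * m ≤⟨ m≤m*n _ (k * m * m) {{m*n≢0 (k * m) m {{m*n≢0 k m}}}} ⟩
      k * k * (q * q * q) * m * (k * m * m) ≡⟨ e₃ k q m ⟩
      w * w * w ∎
      where
      e₃ : ∀ k q m → k * k * (q * q * q) * m * (k * m * m) ≡ k * q * m * (k * q * m) * (k * q * m)
      e₃ = solve-∀
    e₁ : ∀ k m q l α ℓ → 2 * k * (2 * (α * (m * (k * (q * (q * q))) * l) * (ℓ * l))) ≡ α * ℓ * 4 * (k * k * (q * q * q) * m * (l * l))
    e₁ = solve-∀
    e₂ : ∀ z → z * z * (z * z) * (z * z) * (z * z) ≡ z * (z * (z * (z * (z * (z * (z * (z * 1)))))))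
    e₂ = solve-∀

-- Rational bounds for the real quantities

fraction : ℕ → (b : ℕ) .{{_ : NonZero b}} → ℚ
fraction a b = ℤ.+ a ℚ./ b

toℚᵘ-fraction : ∀ a b → toℚᵘ (fraction a (suc b)) ℚᵘ.≃ mkℚᵘ (ℤ.+ a) b
toℚᵘ-fraction a b = ℚ.toℚᵘ-fromℚᵘ (mkℚᵘ (ℤ.+ a) b)

fraction-≤ : ∀ a b c d .{{_ : NonZero b}} .{{_ : NonZero d}} → a * d ≤ c * b → fraction a b ℚ.≤ fraction c d
fraction-≤ a (suc b) c (suc d) le = ℚ.toℚᵘ-cancel-≤
  (ℚᵘ.≤-respˡ-≃ (ℚᵘ.≃-sym (toℚᵘ-fraction a b)) (ℚᵘ.≤-respʳ-≃ (ℚᵘ.≃-sym (toℚᵘ-fraction c d))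
    (*≤* (subst₂ ℤ._≤_ (ℤ.pos-* a (suc d)) (ℤ.pos-* c (suc b)) (ℤ.+≤+ le)))))

fraction-< : ∀ a b c d .{{_ : NonZero b}} .{{_ : NonZero d}} → a * d < c * b → fraction a b ℚ.< fraction c d
fraction-< a (suc b) c (suc d) lt = ℚ.toℚᵘ-cancel-<
  (ℚᵘ.<-respˡ-≃ (ℚᵘ.≃-sym (toℚᵘ-fraction a b)) (ℚᵘ.<-respʳ-≃ (ℚᵘ.≃-sym (toℚᵘ-fraction c d))
    (*<* (subst₂ ℤ._<_ (ℤ.pos-* a (suc d)) (ℤ.pos-* c (suc b)) (ℤ.+<+ lt)))))

fromℕ-mono-≤ : ∀ {a b} → a ≤ b → fromℕ a ℚ.≤ fromℕ b
fromℕ-mono-≤ {a} {b} le = fraction-≤ a 1 b 1 (*-monoˡ-≤ 1 le)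

fromℕ-mono-< : ∀ {a b} → a < b → fromℕ a ℚ.< fromℕ b
fromℕ-mono-< {a} {b} lt = fraction-< a 1 b 1 (*-monoˡ-< 1 lt)

fromℕ-cancel-≤ : ∀ {a b} → fromℕ a ℚ.≤ fromℕ b → a ≤ b
fromℕ-cancel-≤ {a} {b} le = ≮⇒≥ λ b<a → ℚ.<-irrefl refl (ℚ.<-≤-trans (fromℕ-mono-< b<a) le)

fromℕ-+ : ∀ a b → fromℕ (a + b) ≡ fromℕ a ℚ.+ fromℕ b
fromℕ-+ a b = ℚ.toℚᵘ-injective (begin
  toℚᵘ (fromℕ (a + b))                       ≈⟨ toℚᵘ-fraction (a + b) 0 ⟩
  mkℚᵘ (ℤ.+ (a + b)) 0                       ≈⟨ *≡* (cong (ℤ._* ℤ.+ 1) (sum a b)) ⟩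
  mkℚᵘ (ℤ.+ a) 0 ℚᵘ.+ mkℚᵘ (ℤ.+ b) 0         ≈⟨ ℚᵘ.+-cong (toℚᵘ-fraction a 0) (toℚᵘ-fraction b 0) ⟨
  toℚᵘ (fromℕ a) ℚᵘ.+ toℚᵘ (fromℕ b)         ≈⟨ ℚ.toℚᵘ-homo-+ (fromℕ a) (fromℕ b) ⟨
  toℚᵘ (fromℕ a ℚ.+ fromℕ b)                 ∎)
  where
  open ℚᵘ.≃-Reasoning
  sum : ∀ a b → ℤ.+ (a + b) ≡ ℤ.+ a ℤ.* ℤ.+ 1 ℤ.+ ℤ.+ b ℤ.* ℤ.+ 1
  sum a b = cong₂ (λ x y → x ℤ.+ y) (sym (ℤ.*-identityʳ (ℤ.+ a))) (sym (ℤ.*-identityʳ (ℤ.+ b)))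

fraction-* : ∀ a b c d .{{_ : NonZero b}} .{{_ : NonZero d}} →
  fraction a b ℚ.* fraction c d ≡ fraction (a * c) (b * d) {{m*n≢0 b d}}
fraction-* a (suc b) c (suc d) = ℚ.toℚᵘ-injective (begin
  toℚᵘ (fraction a (suc b) ℚ.* fraction c (suc d))            ≈⟨ ℚ.toℚᵘ-homo-* (fraction a (suc b)) (fraction c (suc d)) ⟩
  toℚᵘ (fraction a (suc b)) ℚᵘ.* toℚᵘ (fraction c (suc d))    ≈⟨ ℚᵘ.*-cong (toℚᵘ-fraction a b) (toℚᵘ-fraction c d) ⟩
  mkℚᵘ (ℤ.+ a) b ℚᵘ.* mkℚᵘ (ℤ.+ c) d                          ≈⟨ *≡* (cong (ℤ._* ℤ.+ (suc b * suc d)) (sym (ℤ.pos-* a c))) ⟩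
  mkℚᵘ (ℤ.+ (a * c)) (d + b * suc d)                          ≈⟨ toℚᵘ-fraction (a * c) (d + b * suc d) ⟨
  toℚᵘ (fraction (a * c) (suc b * suc d))                     ∎)
  where open ℚᵘ.≃-Reasoning

fromℕ-* : ∀ a b → fromℕ (a * b) ≡ fromℕ a ℚ.* fromℕ b
fromℕ-* a b = sym (fraction-* a 1 b 1)

fraction-cancel : ∀ b .{{_ : NonZero b}} → fraction 1 b ℚ.* fromℕ b ≡ 1ℚ
fraction-cancel b = trans (fraction-* 1 b b 1) (ℚ.≤-antisym
  (fraction-≤ (1 * b) (b * 1) 1 1 {{m*n≢0 b 1}} (≤-reflexive (e b)))
  (fraction-≤ 1 1 (1 * b) (b * 1) {{_}} {{m*n≢0 b 1}} (≤-reflexive (sym (e b)))))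
  where
  e : ∀ b → 1 * b * 1 ≡ 1 * (b * 1)
  e = solve-∀

0≤fromℕ : ∀ a → 0ℚ ℚ.≤ fromℕ a
0≤fromℕ a = fromℕ-mono-≤ {0} {a} z≤n

fromℕ-nonNeg : ∀ a → ℚ.NonNegative (fromℕ a)
fromℕ-nonNeg a = ℚ.nonNegative (0≤fromℕ a)

fromℕ-pos : ∀ a .{{_ : NonZero a}} → ℚ.Positive (fromℕ a)
fromℕ-pos a = ℚ.positive (fromℕ-mono-< (ℕ.>-nonZero⁻¹ a))

*-mono-≤ᵠ : ∀ {p q r t} → 0ℚ ℚ.≤ r → 0ℚ ℚ.≤ q → p ℚ.≤ q → r ℚ.≤ t → p ℚ.* r ℚ.≤ q ℚ.* t
*-mono-≤ᵠ {p} {q} {r} {t} 0≤r 0≤q p≤q r≤t = ℚ.≤-trans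
  (ℚ.*-monoʳ-≤-nonNeg r {{ℚ.nonNegative 0≤r}} p≤q)
  (ℚ.*-monoˡ-≤-nonNeg q {{ℚ.nonNegative 0≤q}} r≤t)

-- C(Λ + m - 1, m), the coefficients of (1 - x)^(-Λ).
multichoose : ℕ → ℕ → ℕ
multichoose zero    Λ       = 1
multichoose (suc m) zero    = 0
multichoose (suc m) (suc Λ) = multichoose (suc m) Λ + multichoose m (suc Λ)

-- The exact ratio of consecutive values is (Λ + m) / (m + 1). Dropping m leaves the ratio of the
-- terms Λ^m / m!, which are therefore dominated.
multichoose-step : ∀ m Λ → Λ * multichoose m Λ ≤ suc m * multichoose (suc m) Λ
multichoose-step m zero    = z≤n
multichoose-step zero (suc Λ) = begin
  suc Λ * 1                          ≡⟨ e Λ ⟩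
  1 + Λ * 1                          ≤⟨ +-monoʳ-≤ 1 (multichoose-step zero Λ) ⟩
  1 + 1 * multichoose 1 Λ            ≡⟨ e′ (multichoose 1 Λ) ⟩
  1 * (multichoose 1 Λ + 1)          ∎
  where
  open ≤-Reasoning
  e : ∀ x → suc x * 1 ≡ 1 + x * 1
  e = solve-∀
  e′ : ∀ x → 1 + 1 * x ≡ 1 * (x + 1)
  e′ = solve-∀
multichoose-step (suc m) (suc Λ) = begin
  suc Λ * (x + y)                                      ≡⟨ e₁ Λ x y ⟩
  Λ * x + x + suc Λ * y                                ≤⟨ +-mono-≤ (+-monoˡ-≤ x (multichoose-step (suc m) Λ)) (multichoose-step m (suc Λ)) ⟩
  suc (suc m) * z + x + suc m * (x + y)                ≤⟨ m≤m+n _ y ⟩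
  suc (suc m) * z + x + suc m * (x + y) + y            ≡⟨ e₂ m x y z ⟩
  suc (suc m) * (z + (x + y))                          ∎
  where
  open ≤-Reasoning
  x y z : ℕ
  x = multichoose (suc m) Λ
  y = multichoose m (suc Λ)
  z = multichoose (suc (suc m)) Λ
  e₁ : ∀ l x y → suc l * (x + y) ≡ l * x + x + suc l * y
  e₁ = solve-∀
  e₂ : ∀ m x y z → suc (suc m) * z + x + suc m * (x + y) + y ≡ suc (suc m) * (z + (x + y))
  e₂ = solve-∀

-- 2^M times the sum over m ≤ M of multichoose m Λ / 2^m
geometricSum : ℕ → ℕ → ℕ
geometricSum zero    Λ = 1
geometricSum (suc M) Λ = 2 * geometricSum M Λ + multichoose (suc M) Λ

-- The partial sums at x = 1/2 of (1 - x)^(-Λ-1) = (1 - x)^(-Λ) + x (1 - x)^(-Λ-1).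
geometricSum-suc : ∀ M Λ → geometricSum (suc M) (suc Λ) ≡ geometricSum (suc M) Λ + geometricSum M (suc Λ)
geometricSum-suc zero    Λ = e (multichoose 1 Λ)
  where
  e : ∀ x → 2 * 1 + (x + 1) ≡ 2 * 1 + x + 1
  e = solve-∀
geometricSum-suc (suc M) Λ = trans (cong (λ g → 2 * g + (z + y)) (geometricSum-suc M Λ))
  (e (geometricSum (suc M) Λ) (geometricSum M (suc Λ)) y z)
  where
  y z : ℕ
  y = multichoose (suc M) (suc Λ)
  z = multichoose (suc (suc M)) Λ
  e : ∀ a b y z → 2 * (a + b) + (z + y) ≡ 2 * a + z + (2 * b + y)
  e = solve-∀

geometricSum-≤ : ∀ M Λ → geometricSum M Λ ≤ 2 ^ Λ * 2 ^ M
geometricSum-≤ zero    Λ       = ≤-trans (ℕ.>-nonZero⁻¹ _ {{m^n≢0 2 Λ}}) (≤-reflexive (sym (*-identityʳ _)))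
geometricSum-≤ (suc M) zero    = ≤-trans (+-monoˡ-≤ 0 (*-monoʳ-≤ 2 (geometricSum-≤ M zero))) (≤-reflexive (e (2 ^ M)))
  where
  e : ∀ x → 2 * (1 * x) + 0 ≡ 1 * (2 * x)
  e = solve-∀
geometricSum-≤ (suc M) (suc Λ) = begin
  geometricSum (suc M) (suc Λ)                  ≡⟨ geometricSum-suc M Λ ⟩
  geometricSum (suc M) Λ + geometricSum M (suc Λ) ≤⟨ +-mono-≤ (geometricSum-≤ (suc M) Λ) (geometricSum-≤ M (suc Λ)) ⟩
  2 ^ Λ * (2 * 2 ^ M) + 2 * 2 ^ Λ * 2 ^ M       ≡⟨ e (2 ^ Λ) (2 ^ M) ⟩
  2 * 2 ^ Λ * (2 * 2 ^ M)                       ∎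
  where
  open ≤-Reasoning
  e : ∀ x y → x * (2 * y) + 2 * x * y ≡ 2 * x * (2 * y)
  e = solve-∀

module _ (ℓ : ℚ) (Λ : ℕ) (0≤ℓ : 0ℚ ℚ.≤ ℓ) (2ℓ≤Λ : fromℕ 2 ℚ.* ℓ ℚ.≤ fromℕ Λ) where

  open ℚ.≤-Reasoning

  private
    rearrange : ∀ t ℓ r x → (t ℚ.* ℓ ℚ.* r) ℚ.* (fromℕ 2 ℚ.* x) ≡ (t ℚ.* x) ℚ.* (fromℕ 2 ℚ.* ℓ) ℚ.* r
    rearrange t ℓ r x = begin-equality
      (t ℚ.* ℓ ℚ.* r) ℚ.* (two ℚ.* x)    ≡⟨ solve 5 (λ t l r w x → (t :* l :* r) :* (w :* x) := (t :* x) :* (w :* l) :* r) refl t ℓ r two x ⟩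
      (t ℚ.* x) ℚ.* (two ℚ.* ℓ) ℚ.* r    ∎
      where
      two : ℚ
      two = fromℕ 2
      open ℚ-Solver.+-*-Solver

  -- Since 2 ℓ ≤ Λ, the left side is at most Λ^m / m!, to which `multichoose-step` applies.
  expTerm-≤ : ∀ m → expTerm m ℓ ℚ.* fromℕ (2 ^ m) ℚ.≤ fromℕ (multichoose m Λ)
  expTerm-≤ zero    = ℚ.≤-refl
  expTerm-≤ (suc m) = begin
    expTerm m ℓ ℚ.* ℓ ℚ.* fraction 1 (suc m) ℚ.* fromℕ (2 * 2 ^ m)
      ≡⟨ cong (expTerm m ℓ ℚ.* ℓ ℚ.* fraction 1 (suc m) ℚ.*_) (fromℕ-* 2 (2 ^ m)) ⟩
    expTerm m ℓ ℚ.* ℓ ℚ.* fraction 1 (suc m) ℚ.* (fromℕ 2 ℚ.* fromℕ (2 ^ m))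
      ≡⟨ rearrange (expTerm m ℓ) ℓ (fraction 1 (suc m)) (fromℕ (2 ^ m)) ⟩
    expTerm m ℓ ℚ.* fromℕ (2 ^ m) ℚ.* (fromℕ 2 ℚ.* ℓ) ℚ.* fraction 1 (suc m)
      ≤⟨ ℚ.*-monoʳ-≤-nonNeg (fraction 1 (suc m)) {{ℚ.nonNegative (fraction-≤ 0 1 1 (suc m) z≤n)}}
           (*-mono-≤ᵠ (*-mono-≤ᵠ ℚ.≤-refl (0≤fromℕ 2) (0≤fromℕ 2) 0≤ℓ) (0≤fromℕ (multichoose m Λ)) (expTerm-≤ m) 2ℓ≤Λ) ⟩
    fromℕ (multichoose m Λ) ℚ.* fromℕ Λ ℚ.* fraction 1 (suc m)
      ≡⟨ cong (ℚ._* fraction 1 (suc m)) (trans (sym (fromℕ-* (multichoose m Λ) Λ)) (cong fromℕ (*-comm (multichoose m Λ) Λ))) ⟩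
    fromℕ (Λ * multichoose m Λ) ℚ.* fraction 1 (suc m)
      ≤⟨ ℚ.*-monoʳ-≤-nonNeg (fraction 1 (suc m)) {{ℚ.nonNegative (fraction-≤ 0 1 1 (suc m) z≤n)}}
           (fromℕ-mono-≤ (multichoose-step m Λ)) ⟩
    fromℕ (suc m * multichoose (suc m) Λ) ℚ.* fraction 1 (suc m)
      ≡⟨ ℚ.*-comm _ (fraction 1 (suc m)) ⟩
    fraction 1 (suc m) ℚ.* fromℕ (suc m * multichoose (suc m) Λ)
      ≡⟨ cong (fraction 1 (suc m) ℚ.*_) (fromℕ-* (suc m) (multichoose (suc m) Λ)) ⟩
    fraction 1 (suc m) ℚ.* (fromℕ (suc m) ℚ.* fromℕ (multichoose (suc m) Λ))
      ≡⟨ ℚ.*-assoc (fraction 1 (suc m)) (fromℕ (suc m)) _ ⟨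
    fraction 1 (suc m) ℚ.* fromℕ (suc m) ℚ.* fromℕ (multichoose (suc m) Λ)
      ≡⟨ cong (ℚ._* fromℕ (multichoose (suc m) Λ)) (fraction-cancel (suc m)) ⟩
    1ℚ ℚ.* fromℕ (multichoose (suc m) Λ)
      ≡⟨ ℚ.*-identityˡ _ ⟩
    fromℕ (multichoose (suc m) Λ) ∎

  expSum-scaled-≤ : ∀ M → expSum M ℓ ℚ.* fromℕ (2 ^ M) ℚ.≤ fromℕ (geometricSum M Λ)
  expSum-scaled-≤ zero    = ℚ.≤-refl
  expSum-scaled-≤ (suc M) = begin
    (expSum M ℓ ℚ.+ expTerm (suc M) ℓ) ℚ.* x                       ≡⟨ ℚ.*-distribʳ-+ x (expSum M ℓ) (expTerm (suc M) ℓ) ⟩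
    expSum M ℓ ℚ.* x ℚ.+ expTerm (suc M) ℓ ℚ.* x
      ≤⟨ ℚ.+-mono-≤ double (expTerm-≤ (suc M)) ⟩
    fromℕ (2 * geometricSum M Λ) ℚ.+ fromℕ (multichoose (suc M) Λ) ≡⟨ fromℕ-+ (2 * geometricSum M Λ) _ ⟨
    fromℕ (geometricSum (suc M) Λ)                                 ∎
    where
    x : ℚ
    x = fromℕ (2 ^ suc M)
    double : expSum M ℓ ℚ.* x ℚ.≤ fromℕ (2 * geometricSum M Λ)
    double = begin
      expSum M ℓ ℚ.* fromℕ (2 * 2 ^ M)            ≡⟨ cong (expSum M ℓ ℚ.*_) (trans (cong fromℕ (*-comm 2 (2 ^ M))) (fromℕ-* (2 ^ M) 2)) ⟩
      expSum M ℓ ℚ.* (fromℕ (2 ^ M) ℚ.* fromℕ 2)  ≡⟨ ℚ.*-assoc (expSum M ℓ) _ (fromℕ 2) ⟨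
      expSum M ℓ ℚ.* fromℕ (2 ^ M) ℚ.* fromℕ 2    ≤⟨ ℚ.*-monoʳ-≤-nonNeg (fromℕ 2) (expSum-scaled-≤ M) ⟩
      fromℕ (geometricSum M Λ) ℚ.* fromℕ 2        ≡⟨ trans (sym (fromℕ-* (geometricSum M Λ) 2)) (cong fromℕ (*-comm (geometricSum M Λ) 2)) ⟩
      fromℕ (2 * geometricSum M Λ)                ∎

  -- A form of exp (Λ / 2) ≤ 2^Λ, by termwise comparison with the series of (1 - x)^(-Λ) at x = 1/2,
  -- whose sum is 2^Λ.
  expSum-≤ : ∀ M → expSum M ℓ ℚ.≤ fromℕ (2 ^ Λ)
  expSum-≤ M = ℚ.*-cancelʳ-≤-pos (fromℕ (2 ^ M)) {{fromℕ-pos (2 ^ M) {{m^n≢0 2 M}}}} (begin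
    expSum M ℓ ℚ.* fromℕ (2 ^ M)       ≤⟨ expSum-scaled-≤ M ⟩
    fromℕ (geometricSum M Λ)           ≤⟨ fromℕ-mono-≤ (geometricSum-≤ M Λ) ⟩
    fromℕ (2 ^ Λ * 2 ^ M)              ≡⟨ fromℕ-* (2 ^ Λ) (2 ^ M) ⟩
    fromℕ (2 ^ Λ) ℚ.* fromℕ (2 ^ M)    ∎)

module _ (ε : ℝ) (m : ℕ) .{{_ : NonZero m}} (ε<1/m : upper ε (fraction 1 m)) where

  lower-< : ∀ {e} → lower ε e → e ℚ.< fraction 1 m
  lower-< {e} le with ℚ.<-cmp e (fraction 1 m)
  ... | tri< lt _ _   = lt
  ... | tri≈ _ refl _ = ⊥-elim (disjoint ε le ε<1/m)
  ... | tri> _ _ gt   = ⊥-elim (disjoint ε (lower-closed ε gt le) ε<1/m)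

  ÷ᵘ-lower-bound : ∀ a x → (a ÷ᵘ ε) x → fromℕ (a * m) ℚ.≤ x
  ÷ᵘ-lower-bound a x (e , 0<e , le , a<xe) = begin
    fromℕ (a * m)                               ≡⟨ fromℕ-* a m ⟩
    fromℕ a ℚ.* fromℕ m                         ≤⟨ ℚ.*-monoʳ-≤-nonNeg (fromℕ m) {{fromℕ-nonNeg m}} (ℚ.<⇒≤ a<xe) ⟩
    x ℚ.* e ℚ.* fromℕ m
      ≤⟨ ℚ.*-monoʳ-≤-nonNeg (fromℕ m) {{fromℕ-nonNeg m}}
           (ℚ.*-monoˡ-≤-nonNeg x {{ℚ.nonNegative x≥0}} (ℚ.<⇒≤ (lower-< le))) ⟩
    x ℚ.* fraction 1 m ℚ.* fromℕ m              ≡⟨ ℚ.*-assoc x _ (fromℕ m) ⟩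
    x ℚ.* (fraction 1 m ℚ.* fromℕ m)            ≡⟨ cong (x ℚ.*_) (fraction-cancel m) ⟩
    x ℚ.* 1ℚ                                    ≡⟨ ℚ.*-identityʳ x ⟩
    x                                           ∎
    where
    open ℚ.≤-Reasoning
    x≥0 : 0ℚ ℚ.≤ x
    x≥0 = ℚ.≮⇒≥ λ x<0 → ℚ.<-irrefl refl (begin-strict
      0ℚ             ≤⟨ 0≤fromℕ a ⟩
      fromℕ a        <⟨ a<xe ⟩
      x ℚ.* e        ≤⟨ ℚ.*-monoʳ-≤-nonNeg e {{ℚ.nonNegative (ℚ.<⇒≤ 0<e)}} (ℚ.<⇒≤ x<0) ⟩
      0ℚ ℚ.* e       ≡⟨ ℚ.*-zeroˡ e ⟩
      0ℚ             ∎)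

  -- If 2 ℓ < Λ, the partial sums of exp ℓ would stay below 2^Λ ≤ a m, yet one of them exceeds a / ε
  -- > a m.
  lnᵘ-lower-bound : ∀ a Λ ℓ → 2 ^ Λ ≤ a * m → lnᵘ (a ÷ᵘ ε) ℓ → fromℕ Λ ℚ.≤ fromℕ 2 ℚ.* ℓ
  lnᵘ-lower-bound a Λ ℓ 2^Λ≤ (0<ℓ , M , e , 0<e , le , a<) = ℚ.≮⇒≥ λ 2ℓ<Λ → ℚ.<-irrefl refl (begin-strict
    fromℕ a ℚ.* fromℕ m          <⟨ ℚ.*-monoˡ-<-pos (fromℕ m) {{fromℕ-pos m}} a< ⟩
    X ℚ.* e ℚ.* fromℕ m
      ≤⟨ ℚ.*-monoʳ-≤-nonNeg (fromℕ m) {{fromℕ-nonNeg m}}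
           (ℚ.*-monoʳ-≤-nonNeg e {{ℚ.nonNegative (ℚ.<⇒≤ 0<e)}} (expSum-≤ ℓ Λ (ℚ.<⇒≤ 0<ℓ) (ℚ.<⇒≤ 2ℓ<Λ) M)) ⟩
    fromℕ (2 ^ Λ) ℚ.* e ℚ.* fromℕ m
      ≤⟨ ℚ.*-monoʳ-≤-nonNeg (fromℕ m) {{fromℕ-nonNeg m}}
           (ℚ.*-monoˡ-≤-nonNeg (fromℕ (2 ^ Λ)) {{fromℕ-nonNeg (2 ^ Λ)}} (ℚ.<⇒≤ (lower-< le))) ⟩
    fromℕ (2 ^ Λ) ℚ.* fraction 1 m ℚ.* fromℕ m   ≡⟨ ℚ.*-assoc (fromℕ (2 ^ Λ)) _ (fromℕ m) ⟩
    fromℕ (2 ^ Λ) ℚ.* (fraction 1 m ℚ.* fromℕ m) ≡⟨ cong (fromℕ (2 ^ Λ) ℚ.*_) (fraction-cancel m) ⟩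
    fromℕ (2 ^ Λ) ℚ.* 1ℚ                         ≡⟨ ℚ.*-identityʳ _ ⟩
    fromℕ (2 ^ Λ)                                ≤⟨ fromℕ-mono-≤ 2^Λ≤ ⟩
    fromℕ (a * m)                                ≡⟨ fromℕ-* a m ⟩
    fromℕ a ℚ.* fromℕ m                          ∎)
    where
    open ℚ.≤-Reasoning
    X : ℚ
    X = expSum M ℓ

  -- The 4 is the square of the 2 in Λ ≤ 2 ln (a′ / ε).
  size-lower-bound : ∀ a a′ Λ s → 2 ^ Λ ≤ a′ * m → 4 * s ≤ a * m * (Λ * Λ) →
                     s ≤ᵘ (a ÷ᵘ ε) ·ᵘ lnᵘ (a′ ÷ᵘ ε) ²
  size-lower-bound a a′ Λ s 2^Λ≤ 4s≤ b (c , d , c∈ , (x , y , x∈ , y∈ , xy<d) , cd<b) =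
    ℚ.*-cancelˡ-≤-pos (fromℕ 4) (begin
      fromℕ 4 ℚ.* fromℕ s                  ≡⟨ fromℕ-* 4 s ⟨
      fromℕ (4 * s)                        ≤⟨ fromℕ-mono-≤ 4s≤ ⟩
      fromℕ (a * m * (Λ * Λ))              ≡⟨ trans (fromℕ-* (a * m) (Λ * Λ)) (cong (fromℕ (a * m) ℚ.*_) (fromℕ-* Λ Λ)) ⟩
      fromℕ (a * m) ℚ.* (fromℕ Λ ℚ.* fromℕ Λ)
        ≤⟨ *-mono-≤ᵠ ΛΛ≥0 (ℚ.≤-trans (0≤fromℕ (a * m)) c≥) c≥
             (*-mono-≤ᵠ (0≤fromℕ Λ) (ℚ.≤-trans (0≤fromℕ Λ) (bound x x∈)) (bound x x∈) (bound y y∈)) ⟩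
      c ℚ.* (fromℕ 2 ℚ.* x ℚ.* (fromℕ 2 ℚ.* y))  ≡⟨ cong (c ℚ.*_) (four x y) ⟩
      c ℚ.* (fromℕ 4 ℚ.* (x ℚ.* y))
        ≤⟨ ℚ.*-monoˡ-≤-nonNeg c {{ℚ.nonNegative (ℚ.≤-trans (0≤fromℕ (a * m)) c≥)}}
             (ℚ.*-monoˡ-≤-nonNeg (fromℕ 4) (ℚ.<⇒≤ xy<d)) ⟩
      c ℚ.* (fromℕ 4 ℚ.* d)                ≡⟨ trans (sym (ℚ.*-assoc c (fromℕ 4) d)) (trans (cong (ℚ._* d) (ℚ.*-comm c (fromℕ 4))) (ℚ.*-assoc (fromℕ 4) c d)) ⟩
      fromℕ 4 ℚ.* (c ℚ.* d)                ≤⟨ ℚ.*-monoˡ-≤-nonNeg (fromℕ 4) (ℚ.<⇒≤ cd<b) ⟩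
      fromℕ 4 ℚ.* b                        ∎)
    where
    open ℚ.≤-Reasoning
    c≥ : fromℕ (a * m) ℚ.≤ c
    c≥ = ÷ᵘ-lower-bound a c c∈
    bound : ∀ ℓ → lnᵘ (a′ ÷ᵘ ε) ℓ → fromℕ Λ ℚ.≤ fromℕ 2 ℚ.* ℓ
    bound ℓ = lnᵘ-lower-bound a′ Λ ℓ 2^Λ≤
    ΛΛ≥0 : 0ℚ ℚ.≤ fromℕ Λ ℚ.* fromℕ Λ
    ΛΛ≥0 = subst (0ℚ ℚ.≤_) (fromℕ-* Λ Λ) (0≤fromℕ (Λ * Λ))
    four : ∀ x y → fromℕ 2 ℚ.* x ℚ.* (fromℕ 2 ℚ.* y) ≡ fromℕ 4 ℚ.* (x ℚ.* y)
    four x y = trans (solve 3 (λ t x y → (t :* x) :* (t :* y) := (t :* t) :* (x :* y)) refl (fromℕ 2) x y)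
                     (cong (ℚ._* (x ℚ.* y)) (sym (fromℕ-* 2 2)))
      where
      open ℚ-Solver.+-*-Solver

-- The gap of a factor 4 leaves room for locatedness, which can only decide between two distinct
-- rationals, here 1/(4 m) and 1/(2 m).
record Approximation (ε : ℝ) : Set where
  field
    m         : ℕ
    {{m≢0}}   : NonZero m
    above     : upper ε (fraction 1 m)
    below     : lower ε (fraction 1 (4 * m) {{m*n≢0 4 m}})

approximate : (ε : ℝ) → lower ε 0ℚ → upper ε 1ℚ → Approximation ε
approximate ε 0<ε ε<1 with lower-rounded ε 0<ε
... | a , 0<a , a<ε = search (ℚ.↧ₙ a) 1 ε<1 (≤-trans (n<2^n (ℚ.↧ₙ a)) (≤-reflexive (sym (*-identityˡ _))))
  where
  1/den≤ : ∀ a → 0ℚ ℚ.< a → fraction 1 (ℚ.↧ₙ a) ℚ.≤ a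
  1/den≤ a@(ℚ.mkℚ (ℤ.+ suc n) d _) _   = subst (fraction 1 (suc d) ℚ.≤_) (ℚ.↥p/↧p≡p a)
    (fraction-≤ 1 (suc d) (suc n) (suc d) (*-monoˡ-≤ (suc d) {1} {suc n} (s≤s z≤n)))
  1/den≤ (ℚ.mkℚ (ℤ.+ zero) d _)    0<a with ℚ.drop-*<* 0<a
  ... | ℤ.+<+ ()
  1/den≤ (ℚ.mkℚ ℤ.-[1+ n ] d _)    0<a with ℚ.drop-*<* 0<a
  ... | ()
  -- m doubles as long as ε < 1/(2 m) is reported. The denominator of `a` stays below m 2^fuel, so
  -- running out of fuel would give ε < 1/m < a, against a < ε.
  search : ∀ fuel m .{{_ : NonZero m}} → upper ε (fraction 1 m) → ℚ.↧ₙ a < m * 2 ^ fuel → Approximation ε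
  search zero m up den<m = ⊥-elim (disjoint ε
    (lower-closed ε (ℚ.<-≤-trans
      (fraction-< 1 m 1 (ℚ.↧ₙ a) (*-monoʳ-< 1 (≤-trans den<m (≤-reflexive (*-identityʳ m))))) (1/den≤ a 0<a)) a<ε)
    up)
  search (suc fuel) m up den< with located ε {fraction 1 (4 * m) {{m*n≢0 4 m}}} {fraction 1 (2 * m) {{m*n≢0 2 m}}}
    (fraction-< 1 (4 * m) 1 (2 * m) {{m*n≢0 4 m}} {{m*n≢0 2 m}} (*-monoʳ-< 1 (*-monoˡ-< m {2} {4} (s≤s (s≤s (s≤s z≤n))))))
  ... | inj₁ low = record { m = m ; m≢0 = ℕ.>-nonZero (ℕ.>-nonZero⁻¹ m) ; above = up ; below = low }
  ... | inj₂ up′ = search fuel (2 * m) {{m*n≢0 2 m}} up′ (≤-trans den< (≤-reflexive (e m (2 ^ fuel))))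
    where
    e : ∀ m x → m * (2 * x) ≡ 2 * m * x
    e = solve-∀

-- The tester

log₂-bracket : ∀ W → 1 ≤ W → ∃ λ Λ → 2 ^ Λ ≤ W × W < 2 ^ suc Λ
log₂-bracket (suc zero)    _ = 0 , s≤s z≤n , s≤s (s≤s z≤n)
log₂-bracket (suc (suc W)) _ with log₂-bracket (suc W) (s≤s z≤n)
... | Λ , lower , upper with suc (suc W) <? 2 ^ suc Λ
...   | yes lt = Λ , m≤n⇒m≤1+n lower , lt
...   | no ≮   = suc Λ , ≮⇒≥ ≮ ,
  ≤-trans (s≤s upper) (≤-trans (+-monoˡ-≤ (2 ^ suc Λ) (ℕ.>-nonZero⁻¹ _ {{m^n≢0 2 (suc Λ)}}))
                               (≤-reflexive (cong (2 ^ suc Λ +_) (sym (+-identityʳ _)))))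

full-subset : (S : Subset n) → ∣ S ∣ ≡ n → ∀ v → T (lookup S v)
full-subset {n} S full v with lookup S v in eq
... | true  = tt
... | false = <-irrefl refl (begin-strict
  ∑ (ind ∘ lookup S)  <⟨ ∑-mono-< (λ u → ind-mono {lookup S u} {true} _) v (subst (λ b → ind b < 1) (sym eq) ≤-refl) ⟩
  ∑ {n} (λ _ → 1)     ≡⟨ trans (∑-const n 1) (*-identityʳ n) ⟩
  n                   ≡⟨ full ⟨
  ∣ S ∣               ≡⟨ ∣ S ∣≡∑ ⟩
  ∑ (ind ∘ lookup S)  ∎)
  where open ≤-Reasoning

inducedTester : ∀ q k → ℕ → CanonicalTester q
inducedTester q k s = record { sampleSize = s ; accepts? = λ H → does (colorable? k H) }

accepting : ∀ {q n} k → Hypergraph q n → ℕ → Subset n → Bool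
accepting k H s S = (∣ S ∣ ℕ.≡ᵇ s) ∧ does (colorable? k (induced H S))

complete : ∀ {q n k} s (H : Hypergraph q n) → Colorable k H → 1ℚ ℚ.≤ acceptProbability (inducedTester q k s) H
complete {q} {n} {k} s H col = fraction-≤ 1 1 (#subsets (accepting k H s′)) (n C s′) {{_}} {{C-nonZero (m⊓n≤n s n)}} (begin
  1 * (n C s′)                         ≡⟨ *-identityˡ _ ⟩
  n C s′                               ≤⟨ #subsets-of-size n s′ (accepting k H s′) (λ S eq →
                                           ∧-intro (≡⇒≡ᵇ ∣ S ∣ s′ eq) (does-intro (colorable? k (induced H S)) (induced-colorable H S col))) ⟩
  #subsets (accepting k H s′)          ≡⟨ *-identityʳ _ ⟨
  #subsets (accepting k H s′) * 1      ∎)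
  where
  open ≤-Reasoning
  s′ : ℕ
  s′ = s ⊓ n

sound-by-count : ∀ {q n k} s (H : Hypergraph q n) → 2 * #subsets (accepting k H (s ⊓ n)) ≤ n C (s ⊓ n) →
                 acceptProbability (inducedTester q k s) H ℚ.≤ ½
sound-by-count {q} {n} {k} s H le = fraction-≤ (#subsets (accepting k H (s ⊓ n))) (n C (s ⊓ n)) 1 2 {{C-nonZero (m⊓n≤n s n)}}
  (≤-trans (≤-reflexive (*-comm (#subsets (accepting k H (s ⊓ n))) 2)) (≤-trans le (≤-reflexive (sym (*-identityˡ _)))))

far-distance : ∀ {q n k} (ε : ℝ) (H : Hypergraph q n) M .{{_ : NonZero M}} → lower ε (fraction 1 M) → Far k ε H →
  ∀ (c : Fin n → Fin k) → n C q ≤ M * distance H (removeMonochromatic H c)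
far-distance {q} {n} ε H M low (_ , far) c = fromℕ-cancel-≤ (begin
  fromℕ (n C q)                                        ≡⟨ ℚ.*-identityˡ _ ⟨
  1ℚ ℚ.* fromℕ (n C q)                                 ≡⟨ cong (ℚ._* fromℕ (n C q)) (trans (ℚ.*-comm (fromℕ M) (fraction 1 M)) (fraction-cancel M)) ⟨
  fromℕ M ℚ.* fraction 1 M ℚ.* fromℕ (n C q)           ≡⟨ ℚ.*-assoc (fromℕ M) (fraction 1 M) _ ⟩
  fromℕ M ℚ.* (fraction 1 M ℚ.* fromℕ (n C q))
    ≤⟨ ℚ.*-monoˡ-≤-nonNeg (fromℕ M) {{fromℕ-nonNeg M}} (far (removeMonochromatic H c) (removeMonochromatic-colorable H c) _ low) ⟩
  fromℕ M ℚ.* fromℕ d                                  ≡⟨ fromℕ-* M d ⟨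
  fromℕ (M * d)                                        ∎)
  where
  open ℚ.≤-Reasoning
  d : ℕ
  d = distance H (removeMonochromatic H c)

-- This is 2 a L with a = α k q³ m Λ and L = ℓ Λ.
samples : (α ℓ q k m Λ : ℕ) → ℕ
samples α ℓ q k m Λ = 2 * (α * (m * (k * (q * (q * q))) * Λ) * (ℓ * Λ))

-- The 8 is the 2 of 2 a L times the 4 of `size-lower-bound`.
samples-≤ : ∀ (ε : ℝ) α ℓ q k m .{{_ : NonZero m}} Λ → upper ε (fraction 1 m) → 2 ^ Λ ≤ k * q * m →
            samples α ℓ q k m Λ ≤ᵘ ((8 * α * ℓ * k * q ^ 3) ÷ᵘ ε) ·ᵘ lnᵘ ((k * q) ÷ᵘ ε) ²
samples-≤ ε α ℓ q k m Λ above W-lower =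
  size-lower-bound ε m above (8 * α * ℓ * k * q ^ 3) (k * q) Λ (samples α ℓ q k m Λ) W-lower
    (≤-reflexive (e α ℓ m k q Λ))
  where
  e : ∀ α ℓ m k q l → 4 * (2 * (α * (m * (k * (q * (q * q))) * l) * (ℓ * l))) ≡ 8 * α * ℓ * k * (q * (q * (q * 1))) * m * (l * l)
  e = solve-∀

-- The theorem takes α = 448 and ℓ = 26.
module Tester (α ℓ : ℕ) (448≤α : 64 * 7 ≤ α) (αℓ-small : α * ℓ * 4 ≤ 2 ^ 16) (24≤ℓ : 24 ≤ ℓ)
  (q″ k′ m : ℕ) .{{_ : NonZero m}} (Λ′ : ℕ) (W-upper : suc k′ * suc (suc q″) * m < 2 ^ suc (suc Λ′))
  where

  q k Λ : ℕ
  q = suc (suc q″)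
  k = suc k′
  Λ = suc Λ′

  open Parameters q k m Λ W-upper

  a L s : ℕ
  a = α * X
  L = ℓ * Λ
  s = samples α ℓ q k m Λ

  X-large : q ≤ X
  X-large = begin
    q                                ≤⟨ m≤m*n q (q * q) ⟩
    q * (q * q)                      ≤⟨ m≤n*m _ k ⟩
    k * (q * (q * q))                ≤⟨ m≤n*m _ m ⟩
    m * (k * (q * (q * q)))          ≤⟨ m≤m*n _ Λ ⟩
    X                                ∎
    where open ≤-Reasoning

  2≤α : 2 ≤ α
  2≤α = ≤-trans (s≤s (s≤s z≤n)) 448≤α

  2≤L : 2 ≤ L
  2≤L = ≤-trans (≤-trans (s≤s (s≤s z≤n)) 24≤ℓ) (m≤m*n ℓ Λ)

  q≤a : q ≤ a
  q≤a = ≤-trans X-large (m≤n*m X α {{ℕ.>-nonZero (≤-trans (s≤s z≤n) 2≤α)}})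

  -- Whenever s ≤ n, this yields q ≤ n and hence n = q + h with h = n ∸ q.
  q≤s : q ≤ s
  q≤s = ≤-trans q≤a (≤-trans (m≤m*n a L {{ℕ.>-nonZero (≤-trans (s≤s z≤n) 2≤L)}}) (m≤n*m (a * L) 2))

  suc-pred-a : suc (a ∸ 1) ≡ a
  suc-pred-a = m+[n∸m]≡n {1} (≤-trans (s≤s z≤n) q≤a)

  module _ {n : ℕ} (H : Hypergraph q n) (¬colorable : ¬ Colorable k H)
    (far : ∀ (c : Fin n → Fin k) → n C q ≤ 4 * m * distance H (removeMonochromatic H c)) where

    -- The χ that the decision process queries: one proper coloring chosen for each accepted sample.
    coloring : Subset n → Fin n → Fin k
    coloring S with colorable? k (induced H S)
    ... | yes col = proj₁ (extend-proper H S zero col)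
    ... | no _    = λ _ → zero

    coloring-proper : ∀ S → Colorable k (induced H S) → ProperOn H S (coloring S)
    coloring-proper S col with colorable? k (induced H S)
    ... | yes col′ = proj₂ (extend-proper H S zero col′)
    ... | no ¬col  = ⊥-elim (¬col col)

    accepted-proper : ∀ s S → T (accepting k H s S) → ProperOn H S (coloring S)
    accepted-proper s S t = coloring-proper S
      (does-elim (colorable? k (induced H S)) (proj₂ (∧-elim {∣ S ∣ ℕ.≡ᵇ s} t)))

    accepted-size : ∀ s S → T (accepting k H s S) → ∣ S ∣ ≡ s
    accepted-size s S t = ≡ᵇ⇒≡ ∣ S ∣ s (proj₁ (∧-elim t))

    -- If n ≤ s, the only sample is the whole vertex set, and accepting it would color H; since q ≤
    -- s, this includes the case n < q. Otherwise the decision process applies.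
    few-accepted : 2 * #subsets (accepting k H (s ⊓ n)) ≤ n C (s ⊓ n)
    few-accepted with ≤-total s n
    ... | inj₂ n≤s rewrite m≥n⇒m⊓n≡n n≤s
      | #subsets-none (accepting k H n) (λ S t → ¬colorable (coloring S , λ e He →
          accepted-proper n S t e He (λ v _ → full-subset S (accepted-size n S t) v))) = z≤n
    ... | inj₁ s≤n rewrite m≤n⇒m⊓n≡m s≤n =
      accepted-≤-half scales-suffice
        (≤-trans (a-suffices α 448≤α) (≤-reflexive (sym suc-pred-a)))
        (λ c → _ , (λ e → removed-edge H c e) , far c)
        (accepting k H s) (accepted-proper s) (accepted-size s)
      where
      open Soundness H (n ∸ q) (sym (m+[n∸m]≡n (≤-trans q≤s s≤n))) coloring zero (a ∸ 1) (4 * m) (5 + Λ) L s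
        {{ℕ.>-nonZero (∸-monoˡ-≤ {2} 1 (≤-trans (s≤s (s≤s z≤n)) q≤a))}}
        {{ℕ.>-nonZero (≤-trans (s≤s z≤n) 2≤L)}}
        2≤L (cong (λ a → 2 * (a * L)) (sym suc-pred-a)) s≤n (fine-suffices α ℓ αℓ-small 24≤ℓ)

HasTester : (K q k n : ℕ) → ℝ → Set
HasTester K q k n ε = ∃ λ (A : CanonicalTester q) → IsTester ½ 1ℚ k n ε A ×
  sampleSize A ≤ᵘ ((K * k * q ^ 3) ÷ᵘ ε) ·ᵘ lnᵘ ((k * q) ÷ᵘ ε) ²

tester-at-scale : ∀ α ℓ → 64 * 7 ≤ α → α * ℓ * 4 ≤ 2 ^ 16 → 24 ≤ ℓ →
  ∀ (q k n : ℕ) (ε : ℝ) m .{{_ : NonZero m}} Λ → 2 ≤ q → 1 ≤ k → 1 ≤ Λ →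
  upper ε (fraction 1 m) → lower ε (fraction 1 (4 * m) {{m*n≢0 4 m}}) →
  2 ^ Λ ≤ k * q * m → k * q * m < 2 ^ suc Λ → HasTester (8 * α * ℓ) q k n ε
tester-at-scale α ℓ 448≤α αℓ-small 24≤ℓ q@(suc (suc q″)) k@(suc k′) n ε m Λ@(suc Λ′) (s≤s (s≤s z≤n)) (s≤s z≤n) (s≤s z≤n)
  above below W-lower W-upper =
  inducedTester q k (samples α ℓ q k m Λ) ,
  ((λ H → complete (samples α ℓ q k m Λ) H) ,
   (λ H far → sound-by-count (samples α ℓ q k m Λ) H (few-accepted H (proj₁ far)
      (far-distance ε H (4 * m) {{m*n≢0 4 m}} below far)))) ,
  samples-≤ ε α ℓ q k m Λ above W-lower
  where open Tester α ℓ 448≤α αℓ-small 24≤ℓ q″ k′ m Λ′ W-upper using (few-accepted)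

tester-exists : ∀ α ℓ → 64 * 7 ≤ α → α * ℓ * 4 ≤ 2 ^ 16 → 24 ≤ ℓ →
  ∀ (q k n : ℕ) (ε : ℝ) → 2 ≤ q → 1 ≤ k → 1 ≤ n → lower ε 0ℚ → upper ε 1ℚ → HasTester (8 * α * ℓ) q k n ε
tester-exists α ℓ 448≤α αℓ-small 24≤ℓ q k n ε 2≤q 1≤k 1≤n 0<ε ε<1 =
  tester-at-scale α ℓ 448≤α αℓ-small 24≤ℓ q k n ε m Λ 2≤q 1≤k 1≤Λ above below (proj₁ (proj₂ bracket)) W-upper
  where
  open Approximation (approximate ε 0<ε ε<1)
  instance
    m-nonZero : NonZero m
    m-nonZero = m≢0
  2≤W : 2 ≤ k * q * m
  2≤W = *-mono-≤ (*-mono-≤ 1≤k 2≤q) (ℕ.>-nonZero⁻¹ m)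
  bracket : ∃ λ Λ → 2 ^ Λ ≤ k * q * m × k * q * m < 2 ^ suc Λ
  bracket = log₂-bracket (k * q * m) (≤-trans (s≤s z≤n) 2≤W)
  Λ : ℕ
  Λ = proj₁ bracket
  W-upper : k * q * m < 2 ^ suc Λ
  W-upper = proj₂ (proj₂ bracket)
  -- As q ≥ 2, k q m is at least 2, whereas Λ = 0 would mean k q m < 2.
  1≤Λ : 1 ≤ Λ
  1≤Λ = ≰⇒> λ Λ≤0 → <⇒≱ W-upper (≤-trans (^-monoʳ-≤ 2 (s≤s Λ≤0)) 2≤W)

corollary2 : ∃ λ (c₀ : ℚ) → ∃ λ (c₁ : ℚ) → ∃ λ (K : ℕ) →
    0ℚ ℚ.≤ c₀ × c₀ ℚ.< c₁ × c₁ ℚ.≤ 1ℚ ×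
    (∀ (q k n : ℕ) (ε : ℝ) → 2 ℕ.≤ q → 1 ℕ.≤ k → 1 ℕ.≤ n →
    lower ε 0ℚ → upper ε 1ℚ →
    ∃ λ (A : CanonicalTester q) →
    IsTester c₀ c₁ k n ε A ×
    sampleSize A ≤ᵘ ((K * k * q ^ 3) ÷ᵘ ε) ·ᵘ lnᵘ ((k * q) ÷ᵘ ε) ²)
corollary2 =
  -- The error is one-sided: colorable inputs are always accepted. The constant is 8 α ℓ.
  ½ , 1ℚ , 8 * 448 * 26 ,
  fraction-≤ 0 1 1 2 z≤n , fraction-< 1 2 1 1 ≤-refl , ℚ.≤-refl ,
  tester-exists 448 26 ≤-refl (≤ᵇ⇒≤ (448 * 26 * 4) (2 ^ 16) tt) (≤ᵇ⇒≤ 24 26 tt)
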